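{- For every nonnegative integer $n$ and every integer $\alpha\ge 4$, $$\overline{A}_{5^\alpha}(625n+125)\equiv 0 \pmod{5}\quad\text{and}\quad \overline{A}_{5^\alpha}(625n+500)\equiv 0 \pmod{5}.$$
   Context: An overpartition of $n$ is a partition of $n$ in which the first occurrence of each distinct part may be overlined. For a positive integer $\ell$, $\overline{A}_\ell(n)$ denotes the number of overpartitions of $n$ into parts not divisible by $\ell$, with $\overline{A}_\ell(0)=1$; equivalently $$\sum_{n\ge 0}\overline{A}_\ell(n)q^n=\frac{(q^\ell;q^\ell)_\infty^2(q^2;q^2)_\infty}{(q;q)_\infty^2(q^{2\ell};q^{2\ell})_\infty},\qquad (a;q)_\infty=\prod_{k\ge 0}(1-aq^k).$$ -}

module Defs where

open import Data.Nat using (ℕ; zero; suc; _+_; _*_; _∸_; _≤?_; _≡ᵇ_; _%_; NonZero)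
open import Data.Bool using (Bool; true; false; if_then_else_)
open import Relation.Nullary.Decidable using (does)

-- Number of overpartitions of n whose parts are ≤ k and not divisible by ℓ.
-- An overpartition is determined by choosing, for each allowed part size j,
-- a multiplicity m_j ≥ 0 and, when m_j ≥ 1, whether the first occurrence of
-- j is overlined (2 choices).  We process part sizes k, k-1, ..., 1.
-- 'divides ℓ j' tests ℓ ∣ j (with the convention that 0 divides only 0).
divides : ℕ → ℕ → Bool
divides zero j = j ≡ᵇ 0
divides (suc l) j = (j % suc l) ≡ᵇ 0

-- sumMult f j n fuel: sum over m ≥ 1 with m*j ≤ n of f (n - m*j),
-- for j ≥ 1; 'fuel' bounds the number of iterations (n suffices).
sumMult : (ℕ → ℕ) → ℕ → ℕ → ℕ → ℕ
sumMult f j n zero = 0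
sumMult f j n (suc fuel) =
  if does (j ≤? n) then f (n ∸ j) + sumMult f j (n ∸ j) fuel else 0

opCount : ℕ → ℕ → ℕ → ℕ
opCount ℓ zero zero = 1
opCount ℓ zero (suc n) = 0
opCount ℓ (suc k) n =
  if divides ℓ (suc k)
  then opCount ℓ k n
  else opCount ℓ k n + 2 * sumMult (opCount ℓ k) (suc k) n n

-- A̅ ℓ n : number of overpartitions of n into parts not divisible by ℓ
-- (all parts are ≤ n); A̅ ℓ 0 = 1.
Abar : ℕ → ℕ → ℕ
Abar ℓ n = opCount ℓ n n

{-# OPTIONS --safe #-}
module Submission where

-- Let θ = Σ (-1)^x q^(x²), summed over all integers x.  By Gauss's identity the generating
-- function A of Abar ℓ satisfies A θ = θ(q^ℓ).  Work modulo 5, where f(q^5) = f^5, and let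
-- U_r extract the coefficients with index ≡ r (mod 5), so that U_r (f^5 g) = f U_r g.
-- Sorting x modulo 5 gives θ = θ(q^25) + q B(q^5) + q^4 C(q^5), and multiplication by 2 + i in
-- the Gaussian integers gives θ² = θ(q^5)² + q B C.  Together they yield, modulo 5,
--   U_0 θ⁴ = θ⁴,  U_0 θ³ = θ(q^5) θ²,  U_0 θ² = 2 θ² - θ(q^5)²,  U_1 θ³ = 3 θ² B,  U_4 θ³ = 3 θ² C.
-- With θ(q^ℓ) = T(q^625) one obtains from A θ^5 = T(q^625) θ⁴ successively
--   U_0 A = T(q^125) θ³,  U_0² A = T(q^25) θ(q^5) θ²,  U_0³ A = T(q^5) (2 θ³ - θ(q^5)² θ),
-- and U_1, U_4 annihilate the last series.

open import Defs
open import Algebra.Bundles using (CommutativeRing; RawRing)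
import Algebra.Properties.CommutativeSemigroup
import Algebra.Properties.Ring
import Algebra.Properties.Semiring.Mult.TCOptimised
import Algebra.Solver.Ring
open import Algebra.Solver.Ring.AlmostCommutativeRing using (fromCommutativeRing; _-Raw-AlmostCommutative⟶_)
open import Data.Bool using (true; false; if_then_else_)
open import Data.Integer as ℤ using (ℤ; +_; -[1+_])
import Data.Integer.Properties as ℤ
import Data.Integer.Tactic.RingSolver as ℤ-Solver
open import Data.Maybe using (Maybe; just; nothing)
open import Data.Nat as ℕ using (ℕ; zero; suc; _≤_; _<_; _%_; _/_; _∸_; _≤?_; _≡ᵇ_; z≤n; s≤s)
import Data.Nat.DivMod as ℕ
import Data.Nat.Properties as ℕ
import Data.Nat.Tactic.RingSolver as ℕ-Solver
open import Data.Product using (_×_; _,_)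
open import Data.Sum using (inj₁; inj₂)
open import Data.Unit using (⊤; tt)
open import Relation.Binary.PropositionalEquality as ≡ using (_≡_)
import Relation.Binary.Reasoning.Setoid
open import Relation.Nullary using (yes; no)
open import Relation.Nullary.Decidable using (dec-true; dec-false)

-- Infinite sums and products are never formed algebraically. An identity about them is proved
-- modulo q^(n+1) for every n, where q is nilpotent and every sum is finite, and `limit` then
-- recovers it coefficient by coefficient. For this reason the algebra is done in an arbitrary
-- commutative ring of characteristic 5, which is instantiated both with all series and with
-- truncated ones. The substitution f(q^5) is not defined either: the power f^5 stands for it.
-- Sorting x modulo 5 therefore yields θ = (θ^5)^5 + q B^5 + q^4 C^5. The Gaussian integers yield
-- the formula for θ² with q^5 in place of q, that is, as an equation between fifth powers, from
-- which a fifth root is extracted. Gauss's identity comes from an exact identity for partial sums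
-- and partial products whose error term vanishes modulo q^(n+1).

sq : ℤ → ℕ
sq x = ℤ.∣ x ∣ ℕ.* ℤ.∣ x ∣

+sq : ∀ x → + sq x ≡ x ℤ.* x
+sq (+ n)    = ℤ.pos-* n n
+sq -[1+ n ] = ≡.refl

sq-neg : ∀ x → sq (ℤ.- x) ≡ sq x
sq-neg x = ≡.cong₂ ℕ._*_ (ℤ.∣-i∣≡∣i∣ x) (ℤ.∣-i∣≡∣i∣ x)

∣n∣≤sq : ∀ x → ℤ.∣ x ∣ ≤ sq x
∣n∣≤sq x with ℤ.∣ x ∣
... | zero  = ℕ.z≤n
... | suc n = ℕ.m≤m+n (suc n) (n ℕ.* suc n)

-- 5 |x + iy|² = |(2 + i)(x + iy)|² in ℤ[i], written in x and u = 2x - y.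
norm-identity : ∀ x u → 5 ℕ.* sq x ℕ.+ 5 ℕ.* sq (+ 2 ℤ.* x ℤ.- u) ≡ sq u ℕ.+ sq (+ 5 ℤ.* x ℤ.- + 2 ℤ.* u)
norm-identity x u = ℤ.+-injective (begin
  + (5 ℕ.* sq x ℕ.+ 5 ℕ.* sq y)              ≡⟨ ℤ.pos-+ (5 ℕ.* sq x) (5 ℕ.* sq y) ⟩
  + (5 ℕ.* sq x) ℤ.+ + (5 ℕ.* sq y)          ≡⟨ ≡.cong₂ ℤ._+_ (ℤ.pos-* 5 (sq x)) (ℤ.pos-* 5 (sq y)) ⟩
  + 5 ℤ.* + sq x ℤ.+ + 5 ℤ.* + sq y          ≡⟨ ≡.cong₂ (λ s t → + 5 ℤ.* s ℤ.+ + 5 ℤ.* t) (+sq x) (+sq y) ⟩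
  + 5 ℤ.* (x ℤ.* x) ℤ.+ + 5 ℤ.* (y ℤ.* y)    ≡⟨ polynomial x u ⟩
  u ℤ.* u ℤ.+ z ℤ.* z                        ≡⟨ ≡.cong₂ ℤ._+_ (+sq u) (+sq z) ⟨
  + sq u ℤ.+ + sq z                          ≡⟨ ℤ.pos-+ (sq u) (sq z) ⟨
  + (sq u ℕ.+ sq z)                          ∎)
  where
  open ≡.≡-Reasoning
  y z : ℤ
  y = + 2 ℤ.* x ℤ.- u
  z = + 5 ℤ.* x ℤ.- + 2 ℤ.* u
  polynomial : ∀ x u → + 5 ℤ.* (x ℤ.* x) ℤ.+ + 5 ℤ.* ((+ 2 ℤ.* x ℤ.- u) ℤ.* (+ 2 ℤ.* x ℤ.- u)) ≡
    u ℤ.* u ℤ.+ (+ 5 ℤ.* x ℤ.- + 2 ℤ.* u) ℤ.* (+ 5 ℤ.* x ℤ.- + 2 ℤ.* u)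
  polynomial = ℤ-Solver.solve-∀

-- Powers, sums and 5-dissections over bare operations

-- Built from the bare operations, so that rings which differ only in their equality share
-- the same powers, products and sums.
module PowersAndSums {a} {A : Set a} (_+_ _*_ : A → A → A) (1# : A) where

  infixr 8 _^_

  _^_ : A → ℕ → A
  x ^ zero  = 1#
  x ^ suc n = x * (x ^ n)

  ∏ : (ℕ → A) → ℕ → A
  ∏ g zero    = 1#
  ∏ g (suc n) = g (suc n) * ∏ g n

  ∑ : ℕ → (ℤ → A) → A
  ∑ zero    f = f (+ 0)
  ∑ (suc n) f = ∑ n f + (f (+ suc n) + f -[1+ n ])

record Parts {a} (A : Set a) : Set a where
  constructor parts
  field part₀ part₁ part₂ part₃ part₄ : A
open Parts

-- The components x_r in Σ q^r x_r(q^5) transform by 'step' under multiplication by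
-- a(q^5) + q b(q^5) + q^4 c(q^5).
module Dissection {a} {A : Set a} (_+_ _*_ : A → A → A) (0# 1# a b c q : A) where

  unit : Parts A
  unit = parts 1# 0# 0# 0# 0#

  step : Parts A → Parts A
  step (parts x₀ x₁ x₂ x₃ x₄) = parts
    ((a * x₀) + ((b * (q * x₄)) + (c * (q * x₁))))
    ((a * x₁) + ((b * x₀) + (c * (q * x₂))))
    ((a * x₂) + ((b * x₁) + (c * (q * x₃))))
    ((a * x₃) + ((b * x₂) + (c * (q * x₄))))
    ((a * x₄) + ((b * x₃) + (c * x₀)))

-- Algebra in characteristic 5

Characteristic5 : ∀ {a b} → CommutativeRing a b → Set b
Characteristic5 R = 1# + 1# + 1# + 1# + 1# ≈ 0#
  where open CommutativeRing R

module Char5 {a b} (R : CommutativeRing a b) (5≈0 : Characteristic5 R) where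

  open CommutativeRing R
  open Algebra.Properties.Semiring.Mult.TCOptimised semiring using (×-homo-+; ×1-homo-*) renaming (_×_ to _·_)
  open Algebra.Properties.Ring ring using (+-cancelʳ; -0#≈0#)
  open Algebra.Properties.CommutativeSemigroup *-commutativeSemigroup public using () renaming (x∙yz≈y∙xz to x*yz≈y*xz)
  open PowersAndSums _+_ _*_ 1# public
  module ≈-Reasoning = Relation.Binary.Reasoning.Setoid setoid

  -- Coefficients are kept reduced, so that the solver's normal forms see 5 = 0.
  coefficients : RawRing _ _
  coefficients = record
    { Carrier = ℕ ; _≈_ = _≡_ ; _+_ = λ m n → (m ℕ.+ n) % 5
    ; _*_ = λ m n → (m ℕ.* n) % 5 ; -_ = λ n → (4 ℕ.* n) % 5 ; 0# = 0 ; 1# = 1 }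

  multiple≈0 : ∀ k → (k ℕ.* 5) · 1# ≈ 0#
  multiple≈0 k = trans (×1-homo-* k 5) (trans (*-congˡ 5≈0) (zeroʳ _))

  reduce : ∀ n → n · 1# ≈ (n % 5) · 1#
  reduce n = begin
    n · 1#                                     ≡⟨ ≡.cong (_· 1#) (ℕ.m≡m%n+[m/n]*n n 5) ⟩
    (n % 5 ℕ.+ n ℕ./ 5 ℕ.* 5) · 1#             ≈⟨ ×-homo-+ 1# (n % 5) _ ⟩
    (n % 5) · 1# + (n ℕ./ 5 ℕ.* 5) · 1#        ≈⟨ +-congˡ (multiple≈0 (n ℕ./ 5)) ⟩
    (n % 5) · 1# + 0#                          ≈⟨ +-identityʳ _ ⟩
    (n % 5) · 1#                               ∎
    where open ≈-Reasoning

  4n≈-n : ∀ n → (4 ℕ.* n) · 1# ≈ - (n · 1#)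
  4n≈-n n = +-cancelʳ (n · 1#) _ _ (begin
    (4 ℕ.* n) · 1# + n · 1#   ≈⟨ ×-homo-+ 1# (4 ℕ.* n) n ⟨
    (4 ℕ.* n ℕ.+ n) · 1#      ≡⟨ ≡.cong (_· 1#) (≡.trans (ℕ.+-comm (4 ℕ.* n) n) (ℕ.*-comm 5 n)) ⟩
    (n ℕ.* 5) · 1#            ≈⟨ multiple≈0 n ⟩
    0#                        ≈⟨ -‿inverseˡ _ ⟨
    - (n · 1#) + n · 1#       ∎)
    where open ≈-Reasoning

  coefficient-hom : coefficients -Raw-AlmostCommutative⟶ fromCommutativeRing R
  coefficient-hom = record
    { ⟦_⟧ = _· 1# ; +-homo = λ m n → trans (sym (reduce (m ℕ.+ n))) (×-homo-+ 1# m n)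
    ; *-homo = λ m n → trans (sym (reduce (m ℕ.* n))) (×1-homo-* m n)
    ; -‿homo = λ n → trans (sym (reduce (4 ℕ.* n))) (4n≈-n n)
    ; 0-homo = refl ; 1-homo = refl }

  coefficient≟ : ∀ m n → Maybe (m · 1# ≈ n · 1#)
  coefficient≟ m n with m % 5 ℕ.≟ n % 5
  ... | yes e = just (trans (reduce m) (trans (reflexive (≡.cong (_· 1#) e)) (sym (reduce n))))
  ... | no _  = nothing

  open Algebra.Solver.Ring coefficients (fromCommutativeRing R) coefficient-hom coefficient≟ public
    using (solve; _:=_; _:+_; _:*_; _:-_; :-_; con; Polynomial)

  ^-congˡ : ∀ n {x y} → x ≈ y → x ^ n ≈ y ^ n
  ^-congˡ zero    x≈y = refl
  ^-congˡ (suc n) x≈y = *-cong x≈y (^-congˡ n x≈y)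

  ^-congʳ : ∀ x {m n} → m ≡ n → x ^ m ≈ x ^ n
  ^-congʳ x m≡n = reflexive (≡.cong (x ^_) m≡n)

  ^-homo-* : ∀ x m n → x ^ (m ℕ.+ n) ≈ x ^ m * x ^ n
  ^-homo-* x zero    n = sym (*-identityˡ _)
  ^-homo-* x (suc m) n = trans (*-congˡ (^-homo-* x m n)) (sym (*-assoc _ _ _))

  ^-assocʳ : ∀ x m n → (x ^ m) ^ n ≈ x ^ (m ℕ.* n)
  ^-assocʳ x m zero    = ^-congʳ x (≡.sym (ℕ.*-zeroʳ m))
  ^-assocʳ x m (suc n) = trans (*-congˡ (^-assocʳ x m n))
    (trans (sym (^-homo-* x m (m ℕ.* n))) (^-congʳ x (≡.sym (ℕ.*-suc m n))))

  ^-distrib-* : ∀ x y n → (x * y) ^ n ≈ x ^ n * y ^ n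
  ^-distrib-* x y zero    = sym (*-identityˡ _)
  ^-distrib-* x y (suc n) = trans (*-congˡ (^-distrib-* x y n))
    (solve 4 (λ a b c d → (a :* b) :* (c :* d) := (a :* c) :* (b :* d)) refl _ _ _ _)

  fifth : ∀ {n} → Polynomial n → Polynomial n
  fifth x = x :* (x :* (x :* (x :* (x :* con 1))))

  frobenius-+ : ∀ x y → (x + y) ^ 5 ≈ x ^ 5 + y ^ 5
  frobenius-+ = solve 2 (λ x y → fifth (x :+ y) := fifth x :+ fifth y) refl

  nonzero-classes : ∀ q β γ → let p = - q in
    (p ^ 1 * β ^ 5 + p ^ 1 * β ^ 5) + (p ^ 4 * γ ^ 5 + p ^ 4 * γ ^ 5) ≈ q * (- (β + β)) ^ 5 + q ^ 4 * (γ + γ) ^ 5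
  nonzero-classes = solve 3 (λ q β γ →
    let p = :- q ; b = (p :* con 1) :* fifth β ; c = (p :* (p :* (p :* (p :* con 1)))) :* fifth γ in
    (b :+ b) :+ (c :+ c) := q :* fifth (:- (β :+ β)) :+ (q :* (q :* (q :* (q :* con 1)))) :* fifth (γ :+ γ)) refl

  class-products : ∀ a q β γ → let p = - q ; b = p ^ 1 * β ^ 5 ; c = p ^ 4 * γ ^ 5 in
    a ^ 5 * a ^ 5 + ((b * c + b * c) + (c * b + c * b)) ≈ (a * a) ^ 5 + (q * (- (β + β) * (γ + γ))) ^ 5
  class-products = solve 4 (λ a q β γ →
    let p = :- q ; b = (p :* con 1) :* fifth β ; c = (p :* (p :* (p :* (p :* con 1)))) :* fifth γ in
    fifth a :* fifth a :+ ((b :* c :+ b :* c) :+ (c :* b :+ c :* b)) :=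
    fifth (a :* a) :+ fifth (q :* ((:- (β :+ β)) :* (γ :+ γ)))) refl

  module PowerParts (a b c q : Carrier) where
    open Dissection _+_ _*_ 0# 1# a b c q public
    Q : Carrier
    Q = a * a + q * (b * c)

    -- A monomial with i factors b and j factors c lies in the class of i - j modulo 5, so up to the
    -- fourth power only i = j reaches class 0. With t = q b c the components are a² + 2t, a³ + 6at
    -- and a⁴ + 12a²t + 6t²; modulo 5 the last two become aQ and Q² (`cube₀`, `fourth₀`).
    square₀ : part₀ (step (step unit)) ≈ (Q + Q) - a * a
    square₀ = solve 4 (λ a b c q → let module P = Dissection _:+_ _:*_ (con 0) (con 1) a b c q ; Q = a :* a :+ q :* (b :* c) in
      part₀ (P.step (P.step P.unit)) := (Q :+ Q) :- a :* a) refl a b c q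

    cube₀ : part₀ (step (step (step unit))) ≈ a * Q
    cube₀ = solve 4 (λ a b c q → let module P = Dissection _:+_ _:*_ (con 0) (con 1) a b c q ; Q = a :* a :+ q :* (b :* c) in
      part₀ (P.step (P.step (P.step P.unit))) := a :* Q) refl a b c q

    -- Class 1 of the cube is 3a²b + 3q b²c = 3Qb, and doubling gives 6 = 1. The doubled form fits
    -- the coefficient 2 of θ³ in the third section of the generating function; `cube₄` is the same
    -- with c for b.
    cube₁ : part₁ (step (step (step unit))) + part₁ (step (step (step unit))) ≈ Q * part₁ (step unit)
    cube₁ = solve 4 (λ a b c q → let module P = Dissection _:+_ _:*_ (con 0) (con 1) a b c q ; Q = a :* a :+ q :* (b :* c) in
      part₁ (P.step (P.step (P.step P.unit))) :+ part₁ (P.step (P.step (P.step P.unit))) := Q :* part₁ (P.step P.unit)) refl a b c q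

    cube₄ : part₄ (step (step (step unit))) + part₄ (step (step (step unit))) ≈ Q * part₄ (step unit)
    cube₄ = solve 4 (λ a b c q → let module P = Dissection _:+_ _:*_ (con 0) (con 1) a b c q ; Q = a :* a :+ q :* (b :* c) in
      part₄ (P.step (P.step (P.step P.unit))) :+ part₄ (P.step (P.step (P.step P.unit))) := Q :* part₄ (P.step P.unit)) refl a b c q

    fourth₀ : part₀ (step (step (step (step unit)))) ≈ Q * Q
    fourth₀ = solve 4 (λ a b c q → let module P = Dissection _:+_ _:*_ (con 0) (con 1) a b c q ; Q = a :* a :+ q :* (b :* c) in
      part₀ (P.step (P.step (P.step (P.step P.unit)))) := Q :* Q) refl a b c q

  expansion : ∀ a b c q f → (a + (q * b + q ^ 4 * c)) * f ≈ a * f + (b * (q * f) + c * (q * (q * (q * (q * f)))))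
  expansion = solve 5 (λ a b c q f → (a :+ (q :* b :+ (q :* (q :* (q :* (q :* con 1)))) :* c)) :* f :=
    a :* f :+ (b :* (q :* f) :+ c :* (q :* (q :* (q :* (q :* f)))))) refl

  y^5*x≈xy*y^4 : ∀ x y → y ^ 5 * x ≈ (x * y) * y ^ 4
  y^5*x≈xy*y^4 x y = trans (*-comm _ _) (sym (*-assoc x y (y ^ 4)))

  xy*[2z-w]≈x*[2yz-wy] : ∀ x y z w → (x * y) * ((z + z) - w) ≈ x * ((y * z + y * z) - w * y ^ 1)
  xy*[2z-w]≈x*[2yz-wy] = solve 4 (λ x y z w → (x :* y) :* ((z :+ z) :- w) := x :* ((y :* z :+ y :* z) :- w :* (y :* con 1))) refl

  xy*zw≈zxw*y : ∀ x y z w → (x * y) * (z * w) ≈ (z * (x * w)) * y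
  xy*zw≈zxw*y = solve 4 (λ x y z w → (x :* y) :* (z :* w) := (z :* (x :* w)) :* y) refl

  [-x]^5 : ∀ x → (- x) ^ 5 ≈ - (x ^ 5)
  [-x]^5 = solve 1 (λ x → fifth (:- x) := :- fifth x) refl

  ^5-comm : ∀ x n → (x ^ n) ^ 5 ≈ (x ^ 5) ^ n
  ^5-comm x n = trans (^-assocʳ x n 5) (trans (^-congʳ x (ℕ.*-comm n 5)) (sym (^-assocʳ x 5 n)))

  -- Sums over symmetric intervals of integers

  ∑-cong : ∀ n {f g} → (∀ x → ℤ.∣ x ∣ ≤ n → f x ≈ g x) → ∑ n f ≈ ∑ n g
  ∑-cong zero    h = h (+ 0) ℕ.z≤n
  ∑-cong (suc n) h = +-cong (∑-cong n λ x l → h x (ℕ.m≤n⇒m≤1+n l))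
                            (+-cong (h _ ℕ.≤-refl) (h _ ℕ.≤-refl))

  ∑-+ : ∀ n f g → ∑ n (λ x → f x + g x) ≈ ∑ n f + ∑ n g
  ∑-+ zero    f g = refl
  ∑-+ (suc n) f g = trans (+-congʳ (∑-+ n f g))
    (solve 6 (λ a b c d e f → (a :+ b) :+ ((c :+ d) :+ (e :+ f)) := (a :+ (c :+ e)) :+ (b :+ (d :+ f))) refl
      _ _ _ _ _ _)

  ∑-*ˡ : ∀ n c f → c * ∑ n f ≈ ∑ n (λ x → c * f x)
  ∑-*ˡ zero    c f = refl
  ∑-*ˡ (suc n) c f = trans (distribˡ _ _ _) (+-cong (∑-*ˡ n c f) (distribˡ _ _ _))

  ∑-*-∑ : ∀ m n f g → ∑ m f * ∑ n g ≈ ∑ m (λ x → ∑ n (λ y → f x * g y))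
  ∑-*-∑ m n f g = begin
    ∑ m f * ∑ n g                      ≈⟨ *-comm _ _ ⟩
    ∑ n g * ∑ m f                      ≈⟨ ∑-*ˡ m _ f ⟩
    ∑ m (λ x → ∑ n g * f x)            ≈⟨ ∑-cong m (λ x _ → trans (*-comm _ _) (∑-*ˡ n (f x) g)) ⟩
    ∑ m (λ x → ∑ n (λ y → f x * g y))  ∎
    where open ≈-Reasoning

  ∑-swap : ∀ m n (f : ℤ → ℤ → Carrier) → ∑ m (λ x → ∑ n (f x)) ≈ ∑ n (λ y → ∑ m (λ x → f x y))
  ∑-swap zero    n f = refl
  ∑-swap (suc m) n f = begin
    ∑ m (λ x → ∑ n (f x)) + (∑ n (f _) + ∑ n (f _))
      ≈⟨ +-cong (∑-swap m n f) (sym (∑-+ n _ _)) ⟩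
    ∑ n (λ y → ∑ m (λ x → f x y)) + ∑ n (λ y → f _ y + f _ y)
      ≈⟨ ∑-+ n _ _ ⟨
    ∑ n (λ y → ∑ (suc m) (λ x → f x y)) ∎
    where open ≈-Reasoning

  ∑-reflect : ∀ n f → ∑ n (λ x → f (ℤ.- x)) ≈ ∑ n f
  ∑-reflect zero    f = refl
  ∑-reflect (suc n) f = +-cong (∑-reflect n f) (+-comm _ _)

  VanishesBeyond : ℕ → (ℤ → Carrier) → Set b
  VanishesBeyond n f = ∀ x → n ℕ.< ℤ.∣ x ∣ → f x ≈ 0#

  ∑-extend : ∀ d {n f} → VanishesBeyond n f → ∑ (d ℕ.+ n) f ≈ ∑ n f
  ∑-extend zero    v = refl
  ∑-extend (suc d) v = trans
    (+-cong (∑-extend d v) (trans (+-cong (v _ (ℕ.s≤s (ℕ.m≤n+m _ d))) (v _ (ℕ.s≤s (ℕ.m≤n+m _ d)))) (+-identityˡ _)))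
    (+-identityʳ _)

  ∑-stable : ∀ {m n f} → VanishesBeyond n f → n ≤ m → ∑ m f ≈ ∑ n f
  ∑-stable {m} {n} {f} v n≤m =
    trans (reflexive (≡.cong (λ k → ∑ k f) (≡.sym (ℕ.m∸n+n≡m n≤m)))) (∑-extend (m ℕ.∸ n) v)

  ∑-shift1 : ∀ n f → ∑ n (λ x → f (ℤ.suc x)) + f (ℤ.- + n) ≈ ∑ n f + f (+ suc n)
  ∑-shift1 zero    f = +-comm _ _
  ∑-shift1 (suc n) f = trans
    (+-congʳ (+-congˡ (+-congˡ (reflexive (≡.cong f (1-[1+n] n))))))
    (trans (solve 4 (λ s a b c → (s :+ (a :+ b)) :+ c := (s :+ b) :+ (a :+ c)) refl _ _ _ _)
    (trans (+-congʳ (∑-shift1 n f))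
      (solve 4 (λ s a b c → (s :+ a) :+ (b :+ c) := (s :+ (a :+ c)) :+ b) refl _ _ _ _)))
    where
    1-[1+n] : ∀ n → ℤ.suc -[1+ n ] ≡ ℤ.- + n
    1-[1+n] zero    = ≡.refl
    1-[1+n] (suc n) = ≡.refl

  ∑-shift⁺ : ∀ {n f} → VanishesBeyond n f → ∀ t {m} → t ℕ.+ n ≤ m → ∑ m (λ x → f (+ t ℤ.+ x)) ≈ ∑ n f
  ∑-shift⁺ {n} {f} v zero    {m} n≤m =
    trans (∑-cong m (λ x _ → reflexive (≡.cong f (ℤ.+-identityˡ x)))) (∑-stable v n≤m)
  ∑-shift⁺ {n} {f} v (suc t) {m} t+n<m = begin
    ∑ m (λ x → f (+ suc t ℤ.+ x))    ≈⟨ ∑-cong m (λ x _ → reflexive (≡.cong f (ℤ-lemma x))) ⟩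
    ∑ m (λ x → g (ℤ.suc x))          ≈⟨ +-identityʳ _ ⟨
    -- A unit shift loses the term at -m and gains the one at m + 1; the wide window m puts both
    -- outside the support of f.
    ∑ m (λ x → g (ℤ.suc x)) + 0#     ≈⟨ +-congˡ (v _ (far-left t+n<m)) ⟨
    ∑ m (λ x → g (ℤ.suc x)) + g (ℤ.- + m)  ≈⟨ ∑-shift1 m g ⟩
    ∑ m g + g (+ suc m)              ≈⟨ +-cong (∑-shift⁺ v t (ℕ.<⇒≤ t+n<m)) (v _ (ℕ.≤-trans (ℕ.s≤s n≤m) (ℕ.m≤n+m _ t))) ⟩
    ∑ n f + 0#                       ≈⟨ +-identityʳ _ ⟩
    ∑ n f ∎
    where
    open ≈-Reasoning
    g : ℤ → Carrier
    g x = f (+ t ℤ.+ x)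
    ℤ-lemma : ∀ x → + suc t ℤ.+ x ≡ + t ℤ.+ ℤ.suc x
    ℤ-lemma x = ≡.trans (≡.cong (ℤ._+ x) (ℤ.+-comm (+ 1) (+ t))) (ℤ.+-assoc (+ t) (+ 1) x)
    n≤m : n ≤ m
    n≤m = ℕ.≤-trans (ℕ.m≤n+m n (suc t)) t+n<m
    far-left : suc t ℕ.+ n ≤ m → n ℕ.< ℤ.∣ + t ℤ.+ ℤ.- + m ∣
    far-left h = ≡.subst (n ℕ.<_) (≡.sym eq) (ℕ.m+n≤o⇒m≤o∸n (suc n) (≡.subst (_≤ m) (ℕ.+-comm (suc t) n ⟨≡⟩ ℕ.+-suc n t) h))
      where
      infixr 5 _⟨≡⟩_
      _⟨≡⟩_ = ≡.trans
      eq : ℤ.∣ + t ℤ.+ ℤ.- + m ∣ ≡ m ℕ.∸ t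
      eq = ≡.cong ℤ.∣_∣ (ℤ.m-n≡m⊖n t m) ⟨≡⟩ ℤ.∣⊖∣-≤ (ℕ.≤-trans (ℕ.m≤m+n t n) (ℕ.<⇒≤ h))

  ∑-shift : ∀ {n f} → VanishesBeyond n f → ∀ t {m} → ℤ.∣ t ∣ ℕ.+ n ≤ m → ∑ m (λ x → f (t ℤ.+ x)) ≈ ∑ n f
  ∑-shift v (+ t) h = ∑-shift⁺ v t h
  ∑-shift {n} {f} v -[1+ t ] {m} h = begin
    ∑ m (λ x → f (-[1+ t ] ℤ.+ x))          ≈⟨ ∑-reflect m _ ⟨
    ∑ m (λ x → f (-[1+ t ] ℤ.+ ℤ.- x))      ≈⟨ ∑-cong m (λ x _ → reflexive (≡.cong f (≡.sym (ℤ.neg-distrib-+ (+ suc t) x)))) ⟩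
    ∑ m (λ x → f (ℤ.- (+ suc t ℤ.+ x)))     ≈⟨ ∑-shift⁺ (λ x l → v (ℤ.- x) (≡.subst (n ℕ.<_) (≡.sym (ℤ.∣-i∣≡∣i∣ x)) l)) (suc t) h ⟩
    ∑ n (λ x → f (ℤ.- x))                   ≈⟨ ∑-reflect n f ⟩
    ∑ n f                                   ∎
    where open ≈-Reasoning

  -- The cut-off 2 + 5n is the one at which each class 0, ±1, ±2 is met exactly for |k| ≤ n, so that
  -- no boundary terms are left over.
  ∑-dissect : ∀ n f → ∑ (2 ℕ.+ n ℕ.* 5) f ≈
    ∑ n (λ k → f (+ 0 ℤ.+ k ℤ.* + 5)) +
    ((∑ n (λ k → f (+ 1 ℤ.+ k ℤ.* + 5)) + ∑ n (λ k → f (-[1+ 0 ] ℤ.+ k ℤ.* + 5))) +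
     (∑ n (λ k → f (+ 2 ℤ.+ k ℤ.* + 5)) + ∑ n (λ k → f (-[1+ 1 ] ℤ.+ k ℤ.* + 5))))
  ∑-dissect zero f = +-assoc _ _ _
  ∑-dissect (suc n) f = trans (+-congʳ (+-congʳ (+-congʳ (+-congʳ (+-congʳ (∑-dissect n f))))))
    -- `a` and `b` with index i are the terms at 5n + i and -(5n + i). For example 5n + 6 = 1 + 5(n
    -- + 1) and -(5n + 4) = 1 - 5(n + 1) both join class 1.
    (solve 15 (λ s0 s1 s1′ s2 s2′ a3 b3 a4 b4 a5 b5 a6 b6 a7 b7 →
      (s0 :+ ((s1 :+ s1′) :+ (s2 :+ s2′))) :+ (a3 :+ b3) :+ (a4 :+ b4) :+ (a5 :+ b5) :+ (a6 :+ b6) :+ (a7 :+ b7)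
      := (s0 :+ (a5 :+ b5)) :+ (((s1 :+ (a6 :+ b4)) :+ (s1′ :+ (a4 :+ b6))) :+ ((s2 :+ (a7 :+ b3)) :+ (s2′ :+ (a3 :+ b7)))))
      refl _ _ _ _ _ _ _ _ _ _ _ _ _ _ _)

  -- Gauss's identity in finite form

  [-1]^2n : ∀ n → (- 1#) ^ n * (- 1#) ^ n ≈ 1#
  [-1]^2n zero    = *-identityˡ _
  [-1]^2n (suc n) = trans (solve 1 (λ x → (:- con 1 :* x) :* (:- con 1 :* x) := x :* x) refl _) ([-1]^2n n)

  [-1]^n² : ∀ n → (- 1#) ^ (n ℕ.* n) ≈ (- 1#) ^ n
  [-1]^n² zero    = refl
  [-1]^n² (suc n) = begin
    (- 1#) ^ (suc n ℕ.+ n ℕ.* suc n)                    ≈⟨ ^-homo-* _ (suc n) _ ⟩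
    (- 1#) ^ suc n * (- 1#) ^ (n ℕ.* suc n)             ≡⟨ ≡.cong (λ k → (- 1#) ^ suc n * (- 1#) ^ k) (ℕ.*-suc n n) ⟩
    (- 1#) ^ suc n * (- 1#) ^ (n ℕ.+ n ℕ.* n)           ≈⟨ *-congˡ (^-homo-* _ n _) ⟩
    (- 1#) ^ suc n * ((- 1#) ^ n * (- 1#) ^ (n ℕ.* n))  ≈⟨ *-congˡ (trans (*-congˡ ([-1]^n² n)) ([-1]^2n n)) ⟩
    (- 1#) ^ suc n * 1#                                 ≈⟨ *-identityʳ _ ⟩
    (- 1#) ^ suc n                                      ∎
    where open ≈-Reasoning

  -‿^ : ∀ x n → (- x) ^ n ≈ (- 1#) ^ n * x ^ n
  -‿^ x n = trans (^-congˡ n (solve 1 (λ x → :- x := :- con 1 :* x) refl x)) (^-distrib-* _ _ n)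

  -- As n and n² have the same parity, the theta term at n is the power (-z)^n with z = q^n, which
  -- is the shape of the terms of `L`.
  [-q^n]^n : ∀ q n → (- (q ^ n)) ^ n ≈ (- q) ^ (n ℕ.* n)
  [-q^n]^n q n = begin
    (- (q ^ n)) ^ n                    ≈⟨ -‿^ _ n ⟩
    (- 1#) ^ n * (q ^ n) ^ n           ≈⟨ *-cong (sym ([-1]^n² n)) (^-assocʳ q n n) ⟩
    (- 1#) ^ (n ℕ.* n) * q ^ (n ℕ.* n) ≈⟨ -‿^ q (n ℕ.* n) ⟨
    (- q) ^ (n ℕ.* n)                  ∎
    where open ≈-Reasoning

  module Gauss (q : Carrier) where

    N D : ℕ → Carrier
    N = ∏ (λ k → 1# - q ^ k)
    D = ∏ (λ k → 1# + q ^ k)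

    -- L n z = Σ_{s=1}^{n} (-1)^s (N n / N s) D (s-1) z^s
    L : ℕ → Carrier → Carrier
    L zero    z = 0#
    L (suc n) z = (1# - q ^ suc n) * L n z + D n * (- z) ^ suc n

    -- A q-difference equation in z. At z = q^(n+1) the factor 1 - z is the one in the recursion for
    -- `L (suc n)`, which carries `gauss` from the argument q^(n+1) to q^(n+2).
    L-scale : ∀ n z → (1# - z) * L n (q * z) ≈ (1# + z) * L n z + (z * N n + D n * (- z) ^ suc n)
    L-scale zero    z = solve 1 (λ z → (con 1 :- z) :* con 0 :=
      (con 1 :+ z) :* con 0 :+ (z :* con 1 :+ con 1 :* (:- z :* con 1))) refl z
    L-scale (suc n) z = begin
      (1# - z) * ((1# - Q) * L n (q * z) + D n * (- (q * z)) ^ suc n)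
        ≈⟨ *-congˡ (+-congˡ (*-congˡ (trans (^-congˡ (suc n) (solve 2 (λ q z → :- (q :* z) := q :* (:- z)) refl q z)) (^-distrib-* q (- z) (suc n))))) ⟩
      (1# - z) * ((1# - Q) * L n (q * z) + D n * (Q * W))
        ≈⟨ solve 5 (λ z Q L d W → (con 1 :- z) :* ((con 1 :- Q) :* L :+ d :* (Q :* W))
             := (con 1 :- Q) :* ((con 1 :- z) :* L) :+ (con 1 :- z) :* (d :* (Q :* W))) refl _ _ _ _ _ ⟩
      (1# - Q) * ((1# - z) * L n (q * z)) + (1# - z) * (D n * (Q * W))
        ≈⟨ +-congʳ (*-congˡ (L-scale n z)) ⟩
      (1# - Q) * ((1# + z) * L n z + (z * N n + D n * W)) + (1# - z) * (D n * (Q * W))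
        ≈⟨ solve 6 (λ z Q L d W N →
             (con 1 :- Q) :* ((con 1 :+ z) :* L :+ (z :* N :+ d :* W)) :+ (con 1 :- z) :* (d :* (Q :* W))
             := (con 1 :+ z) :* ((con 1 :- Q) :* L :+ d :* W) :+
                (z :* ((con 1 :- Q) :* N) :+ ((con 1 :+ Q) :* d) :* (:- z :* W))) refl _ _ _ _ _ _ ⟩
      (1# + z) * L (suc n) z + (z * N (suc n) + D (suc n) * (- z) ^ suc (suc n)) ∎
      where
      open ≈-Reasoning
      Q W : Carrier
      Q = q ^ suc n
      W = (- z) ^ suc n

    -- `L n z` has no constant term in z, so the error is a multiple of q^(n+1) and disappears once
    -- that power is zero.
    gauss : ∀ n → D n * ∑ n (λ x → (- q) ^ sq x) ≈ N n + (L n (q ^ suc n) + L n (q ^ suc n))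
    gauss zero    = solve 0 (con 1 :* con 1 := con 1 :+ (con 0 :+ con 0)) refl
    gauss (suc n) = begin
      ((1# + z) * D n) * (T + (E + E))
        ≈⟨ *-congˡ (+-congˡ (+-cong (sym ([-q^n]^n q (suc n))) (sym ([-q^n]^n q (suc n))))) ⟩
      ((1# + z) * D n) * (T + (w + w))
        ≈⟨ solve 4 (λ z d t w → ((con 1 :+ z) :* d) :* (t :+ (w :+ w)) :=
             (con 1 :+ z) :* (d :* t) :+ (con 1 :+ z) :* (d :* (w :+ w))) refl _ _ _ _ ⟩
      (1# + z) * (D n * T) + (1# + z) * (D n * (w + w))
        ≈⟨ +-congʳ (*-congˡ (gauss n)) ⟩
      (1# + z) * (N n + (L n z + L n z)) + (1# + z) * (D n * (w + w))
        ≈⟨ solve 5 (λ z d w L N →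
             (con 1 :+ z) :* (N :+ (L :+ L)) :+ (con 1 :+ z) :* (d :* (w :+ w)) :=
             (con 1 :- z) :* N :+ ((((con 1 :+ z) :* L :+ (z :* N :+ d :* w)) :+ d :* (z :* w))
                               :+ (((con 1 :+ z) :* L :+ (z :* N :+ d :* w)) :+ d :* (z :* w)))) refl _ _ _ _ _ ⟩
      N (suc n) + ((((1# + z) * L n z + (z * N n + D n * w)) + D n * (z * w)) +
                   (((1# + z) * L n z + (z * N n + D n * w)) + D n * (z * w)))
        ≈⟨ +-congˡ (+-cong L-step L-step) ⟨
      N (suc n) + (L (suc n) (q * z) + L (suc n) (q * z)) ∎
      where
      open ≈-Reasoning
      z w T E : Carrier
      z = q ^ suc n
      w = (- z) ^ suc n
      T = ∑ n (λ x → (- q) ^ sq x)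
      E = (- q) ^ (suc n ℕ.* suc n)
      L-step : L (suc n) (q * z) ≈ ((1# + z) * L n z + (z * N n + D n * w)) + D n * (z * w)
      L-step = +-cong (L-scale n z) (*-congˡ (trans (^-congˡ (suc n) (solve 2 (λ q z → :- (q :* z) := q :* (:- z)) refl q z)) (^-distrib-* q (- z) (suc n))))

    L-zero : ∀ n {z} → z ≈ 0# → L n z ≈ 0#
    L-zero zero    z≈0 = refl
    L-zero (suc n) z≈0 = trans (+-cong (trans (*-congˡ (L-zero n z≈0)) (zeroʳ _))
      (trans (*-congˡ (trans (*-congʳ (trans (-‿cong z≈0) -0#≈0#)) (zeroˡ _))) (zeroʳ _))) (+-identityˡ _)

    gauss-nilpotent : ∀ n → q ^ suc n ≈ 0# → D n * ∑ n (λ x → (- q) ^ sq x) ≈ N n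
    gauss-nilpotent n z≈0 = trans (gauss n) (trans (+-congˡ (trans (+-cong (L-zero n z≈0) (L-zero n z≈0)) (+-identityˡ _))) (+-identityʳ _))

  -- Effect of one part size on the product formula

  ∏-cong : ∀ {f g} → (∀ k → f k ≈ g k) → ∀ n → ∏ f n ≈ ∏ g n
  ∏-cong f≈g zero    = refl
  ∏-cong f≈g (suc n) = *-cong (f≈g (suc n)) (∏-cong f≈g n)

  -- The hypothesis says w = xz/(1 - z), the contribution of positive multiplicities. Each of them
  -- comes overlined or not, so x is multiplied by 1 + 2z/(1 - z) = (1 + z)/(1 - z).
  allow-part : ∀ {x w z} → w ≈ z * (x + w) → (1# - z) * (x + (w + w)) ≈ (1# + z) * x
  allow-part {x} {w} {z} w≈ = begin
    (1# - z) * (x + (w + w))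
      ≈⟨ solve 3 (λ x w z → (con 1 :- z) :* (x :+ (w :+ w)) := ((con 1 :- z) :* x :+ (w :+ w)) :- z :* (w :+ w)) refl x w z ⟩
    ((1# - z) * x + (w + w)) - z * (w + w)
      ≈⟨ +-congʳ (+-congˡ (+-cong w≈ w≈)) ⟩
    ((1# - z) * x + (z * (x + w) + z * (x + w))) - z * (w + w)
      ≈⟨ solve 3 (λ x w z → ((con 1 :- z) :* x :+ (z :* (x :+ w) :+ z :* (x :+ w))) :- z :* (w :+ w) := (con 1 :+ z) :* x) refl x w z ⟩
    (1# + z) * x ∎
    where open ≈-Reasoning

  count-allowed : ∀ {o o′ z n d D N} → (1# - z) * o′ ≈ (1# + z) * o → (o * n) * d ≈ D * N →
    (o′ * ((1# - z) * n)) * d ≈ ((1# + z) * D) * N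
  count-allowed {o} {o′} {z} {n} {d} {D} {N} e h = trans
    (solve 4 (λ o′ y n d → (o′ :* (y :* n)) :* d := (y :* o′) :* (n :* d)) refl o′ (1# - z) n d)
    (trans (*-congʳ e) (trans (trans (*-assoc _ _ _) (*-congˡ (trans (sym (*-assoc _ _ _)) h))) (sym (*-assoc _ _ _))))

  count-forbidden : ∀ {o z n d D N} → (o * n) * d ≈ D * N →
    (o * ((1# - z) * n)) * ((1# + z) * d) ≈ ((1# + z) * D) * ((1# - z) * N)
  count-forbidden {o} {z} {n} {d} {D} {N} h = trans
    (solve 5 (λ o y x n d → (o :* (y :* n)) :* (x :* d) := (x :* y) :* ((o :* n) :* d)) refl o (1# - z) (1# + z) n d)
    (trans (*-congˡ h) (solve 4 (λ y x D N → (x :* y) :* (D :* N) := (x :* D) :* (y :* N)) refl (1# - z) (1# + z) D N))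

  -- Multiplication by 2 + i on sums of two squares

  module TwoSquares (p : Carrier) (n : ℕ) (p^>n≈0 : ∀ {m} → n ℕ.< m → p ^ m ≈ 0#) where

    e : ℤ → Carrier
    e x = p ^ sq x

    class : ℤ → ℕ → Carrier
    class r m = ∑ m (λ k → e (r ℤ.+ k ℤ.* + 5))

    e-vanishes : VanishesBeyond n e
    e-vanishes x l = p^>n≈0 (ℕ.≤-trans l (∣n∣≤sq x))

    class-neg : ∀ r m → class (ℤ.- r) m ≈ class r m
    class-neg r m = trans (sym (∑-reflect m _)) (∑-cong m λ k _ →
      reflexive (≡.cong (p ^_) (≡.trans (≡.cong sq (lemma r k)) (sq-neg (r ℤ.+ k ℤ.* + 5)))))
      where
      lemma : ∀ r k → ℤ.- r ℤ.+ (ℤ.- k) ℤ.* + 5 ≡ ℤ.- (r ℤ.+ k ℤ.* + 5)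
      lemma = ℤ-Solver.solve-∀

    v : ℤ → Carrier
    v x = e x ^ 5

    v-vanishes : VanishesBeyond n v
    v-vanishes x l = trans (^-congˡ 5 (e-vanishes x l)) (zeroˡ _)

    -- The term of the pair (x, y) in the square of the sum of `v`, with y replaced by u = 2x - y.
    -- In these coordinates `norm-identity` splits it into a factor for u and one for 5x - 2u.
    w : ℤ → ℤ → Carrier
    w u x = v x * v (+ 2 ℤ.* x ℤ.- u)

    w-vanishes : ∀ u → VanishesBeyond n (w u)
    w-vanishes u x l = trans (*-congʳ (v-vanishes x l)) (zeroˡ _)

    w-e : ∀ u x → w u x ≈ e u * e (+ 5 ℤ.* x ℤ.- + 2 ℤ.* u)
    w-e u x = begin
      v x * v y                                    ≈⟨ *-cong (^-assocʳ p (sq x) 5) (^-assocʳ p (sq y) 5) ⟩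
      p ^ (sq x ℕ.* 5) * p ^ (sq y ℕ.* 5)          ≈⟨ ^-homo-* p (sq x ℕ.* 5) _ ⟨
      p ^ (sq x ℕ.* 5 ℕ.+ sq y ℕ.* 5)              ≡⟨ ≡.cong (p ^_) (≡.trans (≡.cong₂ ℕ._+_ (ℕ.*-comm (sq x) 5) (ℕ.*-comm (sq y) 5)) (norm-identity x u)) ⟩
      p ^ (sq u ℕ.+ sq (+ 5 ℤ.* x ℤ.- + 2 ℤ.* u))  ≈⟨ ^-homo-* p (sq u) _ ⟩
      e u * e (+ 5 ℤ.* x ℤ.- + 2 ℤ.* u)            ∎
      where
      open ≈-Reasoning
      y : ℤ
      y = + 2 ℤ.* x ℤ.- u

    -- For fixed x the passage from y to u is a reflection and a shift by 2x. The window has to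
    -- contain |2x| + n ≤ 3n; it is taken as 2 + 5n to suit `∑-dissect`.
    row-substitution : ∀ x → ℤ.∣ x ∣ ≤ n → ∑ n v ≈ ∑ (2 ℕ.+ n ℕ.* 5) (λ u → v (+ 2 ℤ.* x ℤ.- u))
    row-substitution x ∣x∣≤n = trans (sym (∑-shift v-vanishes (+ 2 ℤ.* x) bound))
                                     (sym (∑-reflect (2 ℕ.+ n ℕ.* 5) _))
      where
      bound : ℤ.∣ + 2 ℤ.* x ∣ ℕ.+ n ≤ 2 ℕ.+ n ℕ.* 5
      bound = ℕ.≤-trans (ℕ.+-monoˡ-≤ n (ℕ.≤-trans (ℕ.≤-reflexive (ℤ.abs-* (+ 2) x)) (ℕ.*-monoʳ-≤ 2 ∣x∣≤n)))
        (ℕ.≤-trans (ℕ.≤-reflexive (≡.trans (ℕ.+-comm _ n) (ℕ.*-comm 3 n))) (ℕ.≤-trans (ℕ.*-monoʳ-≤ n {3} {5} (ℕ.s≤s (ℕ.s≤s (ℕ.s≤s ℕ.z≤n)))) (ℕ.m≤n+m _ 2)))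

    -- Shifting x by 2k + τ separates the two variables: 5 (x + 2k + τ) - 2 (r + 5k) = (5τ - 2r) + 5x.
    separate : ∀ r τ → ℤ.∣ τ ∣ ≤ 1 →
      ∑ n (λ k → ∑ n (w (r ℤ.+ k ℤ.* + 5))) ≈ class r n * class (+ 5 ℤ.* τ ℤ.- + 2 ℤ.* r) (1 ℕ.+ 3 ℕ.* n)
    separate r τ ∣τ∣≤1 = begin
      ∑ n (λ k → ∑ n (w (r ℤ.+ k ℤ.* + 5)))
        ≈⟨ ∑-cong n (λ k l → sym (∑-shift (w-vanishes (r ℤ.+ k ℤ.* + 5)) (τ ℤ.+ + 2 ℤ.* k) (bound k l))) ⟩
      ∑ n (λ k → ∑ (1 ℕ.+ 3 ℕ.* n) (λ x → w (r ℤ.+ k ℤ.* + 5) (τ ℤ.+ + 2 ℤ.* k ℤ.+ x)))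
        ≈⟨ ∑-cong n (λ k _ → ∑-cong (1 ℕ.+ 3 ℕ.* n) (λ x _ →
             trans (w-e (r ℤ.+ k ℤ.* + 5) (τ ℤ.+ + 2 ℤ.* k ℤ.+ x)) (*-congˡ (reflexive (≡.cong e (lemma r τ k x)))))) ⟩
      ∑ n (λ k → ∑ (1 ℕ.+ 3 ℕ.* n) (λ x → e (r ℤ.+ k ℤ.* + 5) * e (+ 5 ℤ.* τ ℤ.- + 2 ℤ.* r ℤ.+ x ℤ.* + 5)))
        ≈⟨ ∑-*-∑ n (1 ℕ.+ 3 ℕ.* n) _ _ ⟨
      class r n * class (+ 5 ℤ.* τ ℤ.- + 2 ℤ.* r) (1 ℕ.+ 3 ℕ.* n) ∎
      where
      open ≈-Reasoning
      lemma : ∀ r τ k x → + 5 ℤ.* (τ ℤ.+ + 2 ℤ.* k ℤ.+ x) ℤ.- + 2 ℤ.* (r ℤ.+ k ℤ.* + 5) ≡ + 5 ℤ.* τ ℤ.- + 2 ℤ.* r ℤ.+ x ℤ.* + 5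
      lemma = ℤ-Solver.solve-∀
      bound : ∀ k → ℤ.∣ k ∣ ≤ n → ℤ.∣ τ ℤ.+ + 2 ℤ.* k ∣ ℕ.+ n ≤ 1 ℕ.+ 3 ℕ.* n
      bound k l = ℕ.≤-trans
        (ℕ.+-monoˡ-≤ n (ℕ.≤-trans (ℤ.∣i+j∣≤∣i∣+∣j∣ τ (+ 2 ℤ.* k))
          (ℕ.+-mono-≤ ∣τ∣≤1 (ℕ.≤-trans (ℕ.≤-reflexive (ℤ.abs-* (+ 2) k)) (ℕ.*-monoʳ-≤ 2 l)))))
        (ℕ.s≤s (ℕ.≤-reflexive (ℕ.+-comm (2 ℕ.* n) n)))

    two-squares : let m = 1 ℕ.+ 3 ℕ.* n in ∑ n v * ∑ n v ≈
      class (+ 0) n * class (+ 0) m +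
      ((class (+ 1) n * class (+ 2) m + class (+ 1) n * class (+ 2) m) +
       (class (+ 2) n * class (+ 1) m + class (+ 2) n * class (+ 1) m))
    two-squares = begin
      ∑ n v * ∑ n v
        ≈⟨ trans (*-comm _ _) (∑-*ˡ n _ v) ⟩
      ∑ n (λ x → ∑ n v * v x)
        ≈⟨ ∑-cong n (λ x l → trans (*-comm _ _) (trans (*-congˡ (row-substitution x l)) (∑-*ˡ (2 ℕ.+ n ℕ.* 5) _ _))) ⟩
      ∑ n (λ x → ∑ (2 ℕ.+ n ℕ.* 5) (λ u → w u x))
        ≈⟨ ∑-swap n (2 ℕ.+ n ℕ.* 5) _ ⟩
      ∑ (2 ℕ.+ n ℕ.* 5) (λ u → ∑ n (w u))
        ≈⟨ ∑-dissect n _ ⟩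
      ∑ n (λ k → ∑ n (w (+ 0 ℤ.+ k ℤ.* + 5))) +
      ((∑ n (λ k → ∑ n (w (+ 1 ℤ.+ k ℤ.* + 5))) + ∑ n (λ k → ∑ n (w (-[1+ 0 ] ℤ.+ k ℤ.* + 5)))) +
       (∑ n (λ k → ∑ n (w (+ 2 ℤ.+ k ℤ.* + 5))) + ∑ n (λ k → ∑ n (w (-[1+ 1 ] ℤ.+ k ℤ.* + 5)))))
        -- τ brings 5τ - 2r back between -2 and 2: τ = 0 for r = 0, ±1 and τ = ±1 for r = ±2.
        -- Multiplication by -2 exchanges the classes ±1 with the classes ±2, so beside class 0 only
        -- mixed products occur.
        ≈⟨ +-cong (separate (+ 0) (+ 0) ℕ.z≤n) (+-cong
             (+-cong (trans (separate (+ 1) (+ 0) ℕ.z≤n) (*-congˡ (class-neg (+ 2) m)))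
                     (trans (separate -[1+ 0 ] (+ 0) ℕ.z≤n) (*-congʳ (class-neg (+ 1) n))))
             (+-cong (separate (+ 2) (+ 1) ℕ.≤-refl)
                     (trans (separate -[1+ 1 ] -[1+ 0 ] ℕ.≤-refl) (*-cong (class-neg (+ 2) n) (class-neg (+ 1) m))))) ⟩
      _ ∎
      where
      open ≈-Reasoning
      m : ℕ
      m = 1 ℕ.+ 3 ℕ.* n

-- Power series with coefficients modulo 5

open import Data.Nat using (_+_; _*_)

infix 4 _≋_

-- A record rather than a bare equation of remainders, so that a and b can be inferred from the
-- type.
record _≋_ (a b : ℕ) : Set where
  constructor mod≡
  field %≡% : a % 5 ≡ b % 5
open _≋_

≋-reflexive : ∀ {a b} → a ≡ b → a ≋ b
≋-reflexive e = mod≡ (≡.cong (_% 5) e)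

≋-refl : ∀ {a} → a ≋ a
≋-refl = mod≡ ≡.refl

≋-sym : ∀ {a b} → a ≋ b → b ≋ a
≋-sym (mod≡ e) = mod≡ (≡.sym e)

≋-trans : ∀ {a b c} → a ≋ b → b ≋ c → a ≋ c
≋-trans (mod≡ e) (mod≡ f) = mod≡ (≡.trans e f)

≋-+ : ∀ {a b c d} → a ≋ b → c ≋ d → a + c ≋ b + d
≋-+ {a} {b} {c} {d} (mod≡ e) (mod≡ f) = mod≡
  (≡.trans (ℕ.%-distribˡ-+ a c 5) (≡.trans (≡.cong₂ (λ s t → (s + t) % 5) e f) (≡.sym (ℕ.%-distribˡ-+ b d 5))))

≋-* : ∀ {a b c d} → a ≋ b → c ≋ d → a * c ≋ b * d
≋-* {a} {b} {c} {d} (mod≡ e) (mod≡ f) = mod≡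
  (≡.trans (ℕ.%-distribˡ-* a c 5) (≡.trans (≡.cong₂ (λ s t → (s * t) % 5) e f) (≡.sym (ℕ.%-distribˡ-* b d 5))))

a+b*5≋a : ∀ a b → a + b * 5 ≋ a
a+b*5≋a a b = mod≡ (ℕ.[m+kn]%n≡m%n a b 5)

-- Adding 4c takes the place of subtracting c.
≋-cancelʳ : ∀ {a b c d} → c ≋ d → a + c ≋ b + d → a ≋ b
≋-cancelʳ {a} {b} {c} {d} c≋d e =
  ≋-trans (≋-sym (a+b*5≋a a c)) (≋-trans (≋-reflexive (lemma a c))
    (≋-trans (≋-+ e (≋-* (≋-refl {4}) c≋d)) (≋-trans (≋-reflexive (≡.sym (lemma b d))) (a+b*5≋a b d))))
  where
  lemma : ∀ a c → a + c * 5 ≡ (a + c) + 4 * c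
  lemma = ℕ-Solver.solve-∀

Series : Set
Series = ℕ → ℕ

tail : Series → Series
tail f n = f (suc n)

infixl 6 _⊕_
infixl 7 _⊛_

_⊕_ : Series → Series → Series
(f ⊕ g) n = f n + g n

-- Coefficients are read modulo 5, where 4 = -1.
⊖_ : Series → Series
(⊖ f) n = 4 * f n

𝟎 𝟏 q : Series
𝟎 _ = 0
𝟏 zero    = 1
𝟏 (suc _) = 0
q zero    = 0
q (suc n) = 𝟏 n

_⊛_ : Series → Series → Series
(f ⊛ g) zero    = f 0 * g 0
(f ⊛ g) (suc n) = f 0 * g (suc n) + (tail f ⊛ g) n

⊛-cong : ∀ {f f′ g g′} n → (∀ i → i ≤ n → f i ≋ f′ i) → (∀ i → i ≤ n → g i ≋ g′ i) → (f ⊛ g) n ≋ (f′ ⊛ g′) n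
⊛-cong zero    h k = ≋-* (h 0 z≤n) (k 0 z≤n)
⊛-cong (suc n) h k = ≋-+ (≋-* (h 0 z≤n) (k (suc n) ℕ.≤-refl))
  (⊛-cong n (λ i l → h (suc i) (s≤s l)) (λ i l → k i (ℕ.m≤n⇒m≤1+n l)))

⊛-distribʳ : ∀ f g h n → ((f ⊕ g) ⊛ h) n ≡ (f ⊛ h) n + (g ⊛ h) n
⊛-distribʳ f g h zero    = ℕ.*-distribʳ-+ (h 0) (f 0) (g 0)
⊛-distribʳ f g h (suc n) =
  ≡.trans (≡.cong (_+_ ((f 0 + g 0) * h (suc n))) (⊛-distribʳ (tail f) (tail g) h n)) (lemma (f 0) (g 0) (h (suc n)) _ _)
  where
  lemma : ∀ a b c d e → (a + b) * c + (d + e) ≡ (a * c + d) + (b * c + e)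
  lemma = ℕ-Solver.solve-∀

⊛-scale : ∀ c f g n → ((λ i → c * f i) ⊛ g) n ≡ c * (f ⊛ g) n
⊛-scale c f g zero    = ℕ.*-assoc c (f 0) (g 0)
⊛-scale c f g (suc n) =
  ≡.trans (≡.cong (_+_ (c * f 0 * g (suc n))) (⊛-scale c (tail f) g n)) (lemma c (f 0) (g (suc n)) _)
  where
  lemma : ∀ c a b d → (c * a) * b + c * d ≡ c * (a * b + d)
  lemma = ℕ-Solver.solve-∀

⊛-zeroˡ : ∀ g n → (𝟎 ⊛ g) n ≡ 0
⊛-zeroˡ g zero    = ≡.refl
⊛-zeroˡ g (suc n) = ⊛-zeroˡ g n

⊛-identityˡ : ∀ g n → (𝟏 ⊛ g) n ≡ g n
⊛-identityˡ g zero    = ℕ.+-identityʳ (g 0)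
⊛-identityˡ g (suc n) = ≡.trans (≡.cong₂ _+_ (ℕ.+-identityʳ _) (⊛-zeroˡ g n)) (ℕ.+-identityʳ _)

⊛-stepʳ : ∀ f g n → (f ⊛ g) (suc n) ≡ f (suc n) * g 0 + (f ⊛ tail g) n
⊛-stepʳ f g zero    = ℕ.+-comm (f 0 * g 1) (f 1 * g 0)
⊛-stepʳ f g (suc n) =
  ≡.trans (≡.cong (_+_ (f 0 * g (suc (suc n)))) (⊛-stepʳ (tail f) g n)) (lemma (f 0 * g (suc (suc n))) (f (suc (suc n)) * g 0) _)
  where
  lemma : ∀ a b c → a + (b + c) ≡ b + (a + c)
  lemma = ℕ-Solver.solve-∀

⊛-comm : ∀ f g n → (f ⊛ g) n ≡ (g ⊛ f) n
⊛-comm f g zero    = ℕ.*-comm (f 0) (g 0)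
⊛-comm f g (suc n) = ≡.trans (≡.cong₂ _+_ (ℕ.*-comm (f 0) _) (⊛-comm (tail f) g n)) (≡.sym (⊛-stepʳ g f n))

⊛-assoc : ∀ f g h n → ((f ⊛ g) ⊛ h) n ≡ (f ⊛ (g ⊛ h)) n
⊛-assoc f g h zero    = ℕ.*-assoc (f 0) (g 0) (h 0)
⊛-assoc f g h (suc n) =
  ≡.trans (≡.cong (_+_ (f 0 * g 0 * h (suc n))) (≡.trans (⊛-distribʳ (λ i → f 0 * tail g i) (tail f ⊛ g) h n)
    (≡.cong₂ _+_ (⊛-scale (f 0) (tail g) h n) (⊛-assoc (tail f) g h n)))) (lemma (f 0) (g 0) (h (suc n)) _ _)
  where
  lemma : ∀ a b c d e → (a * b) * c + (a * d + e) ≡ a * (b * c + d) + e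
  lemma = ℕ-Solver.solve-∀

-- In coefficient m of the product, `g m` has the factor `f 0`, which is 1, and everything else
-- involves earlier coefficients of g, which agree by induction.
⊛-cancelˡ : ∀ {f f′ g g′} n → f 0 ≋ 1 → (∀ i → i ≤ n → f i ≋ f′ i) →
  (∀ i → i ≤ n → (f ⊛ g) i ≋ (f′ ⊛ g′) i) → ∀ i → i ≤ n → g i ≋ g′ i
⊛-cancelˡ {f} {f′} {g} {g′} n f0≋1 f≋f′ fg≋fg′ i i≤n = below n ℕ.≤-refl i i≤n
  where
  unit : ∀ k {a} → f k ≋ 1 → f k * a ≋ a
  unit k {a} e = ≋-trans (≋-* e ≋-refl) (≋-reflexive (ℕ.+-identityʳ a))
  unit′ : ∀ {a} → f′ 0 * a ≋ a
  unit′ {a} = ≋-trans (≋-* (≋-trans (≋-sym (f≋f′ 0 z≤n)) f0≋1) ≋-refl) (≋-reflexive (ℕ.+-identityʳ a))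
  below : ∀ m → m ≤ n → ∀ i → i ≤ m → g i ≋ g′ i
  below zero    _   zero _ = ≋-trans (≋-sym (unit 0 f0≋1)) (≋-trans (fg≋fg′ 0 z≤n) unit′)
  below (suc m) m<n i i≤1+m with ℕ.m≤n⇒m<n∨m≡n i≤1+m
  ... | inj₁ (s≤s i≤m) = below m (ℕ.<⇒≤ m<n) i i≤m
  ... | inj₂ ≡.refl    = ≋-trans (≋-sym (unit 0 f0≋1)) (≋-trans
    (≋-cancelʳ (⊛-cong m (λ i l → f≋f′ (suc i) (ℕ.≤-trans (s≤s l) m<n)) (below m (ℕ.<⇒≤ m<n))) (fg≋fg′ (suc m) m<n)) unit′)

-- Equality is tested at the indices in `P` only; downward closure makes it compatible with
-- products. Carrier and operations do not depend on `P`, so the same terms serve for full and for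
-- truncated series.
module SeriesRing (P : ℕ → Set) (downward : ∀ {i j} → i ≤ j → P j → P i) where

  infix 4 _≈_
  record _≈_ (f g : Series) : Set where
    constructor coefficientwise
    field at : ∀ i → P i → f i ≋ g i
  open _≈_ public

  from-≡ : ∀ {f g} → (∀ i → f i ≡ g i) → f ≈ g
  from-≡ e = coefficientwise λ i _ → ≋-reflexive (e i)

  below : ∀ {f g} → f ≈ g → ∀ n → P n → ∀ i → i ≤ n → f i ≋ g i
  below e n p i i≤n = at e i (downward i≤n p)

  ring : CommutativeRing _ _
  ring = record
    { Carrier = Series ; _≈_ = _≈_ ; _+_ = _⊕_ ; _*_ = _⊛_ ; -_ = ⊖_ ; 0# = 𝟎 ; 1# = 𝟏
    ; isCommutativeRing = record
      { isRing = record
        { +-isAbelianGroup = record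
          { isGroup = record
            { isMonoid = record
              { isSemigroup = record
                { isMagma = record
                  { isEquivalence = record
                    { refl  = coefficientwise λ i _ → ≋-refl
                    ; sym   = λ e → coefficientwise λ i p → ≋-sym (at e i p)
                    ; trans = λ e f → coefficientwise λ i p → ≋-trans (at e i p) (at f i p) }
                  ; ∙-cong = λ e f → coefficientwise λ i p → ≋-+ (at e i p) (at f i p) }
                ; assoc = λ f g h → from-≡ λ i → ℕ.+-assoc (f i) (g i) (h i) }
              ; identity = (λ f → from-≡ λ i → ≡.refl) , (λ f → from-≡ λ i → ℕ.+-identityʳ (f i)) }
            ; inverse = (λ f → coefficientwise λ i _ → ≋-trans (≋-reflexive (4a+a (f i))) (a+b*5≋a 0 (f i)))
                      , (λ f → coefficientwise λ i _ → ≋-trans (≋-reflexive (a+4a (f i))) (a+b*5≋a 0 (f i)))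
            ; ⁻¹-cong = λ e → coefficientwise λ i p → ≋-* (≋-refl {4}) (at e i p) }
          ; comm = λ f g → from-≡ λ i → ℕ.+-comm (f i) (g i) }
        ; *-cong = λ e f → coefficientwise λ i p → ⊛-cong i (below e i p) (below f i p)
        ; *-assoc = λ f g h → from-≡ (⊛-assoc f g h)
        ; *-identity = (λ f → from-≡ (⊛-identityˡ f))
                     , (λ f → from-≡ λ i → ≡.trans (⊛-comm f 𝟏 i) (⊛-identityˡ f i))
        ; distrib = (λ f g h → from-≡ λ i → ≡.trans (⊛-comm f (g ⊕ h) i)
                      (≡.trans (⊛-distribʳ g h f i) (≡.cong₂ _+_ (⊛-comm g f i) (⊛-comm h f i))))
                  , (λ f g h → from-≡ (⊛-distribʳ g h f)) }
      ; *-comm = λ f g → from-≡ (⊛-comm f g) } }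
    where
    4a+a : ∀ a → 4 * a + a ≡ 0 + a * 5
    4a+a = ℕ-Solver.solve-∀
    a+4a : ∀ a → a + 4 * a ≡ 0 + a * 5
    a+4a = ℕ-Solver.solve-∀

  char5 : 𝟏 ⊕ 𝟏 ⊕ 𝟏 ⊕ 𝟏 ⊕ 𝟏 ≈ 𝟎
  char5 = coefficientwise λ { zero _ → mod≡ ≡.refl ; (suc i) _ → mod≡ ≡.refl }

  *-cancelˡ : ∀ f {g h} → f 0 ≋ 1 → f ⊛ g ≈ f ⊛ h → g ≈ h
  *-cancelˡ f f0 e = coefficientwise λ i p →
    ⊛-cancelˡ {f} {f} i f0 (λ _ _ → ≋-refl) (below e i p) i ℕ.≤-refl

  open CommutativeRing ring public hiding (_≈_; ring; zero; _+_; _*_; -_)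
  open Char5 ring char5 public

module Full = SeriesRing (λ _ → ⊤) (λ _ _ → tt)

-- Equality modulo q^(n+1).
module Modulo (n : ℕ) = SeriesRing (_≤ n) ℕ.≤-trans

-- Truncation, Frobenius and the sections `U`

module Multisection where

  open Full hiding (_-_)

  truncate : ∀ {f g} → f ≈ g → ∀ n → Modulo._≈_ n f g
  truncate e n = Modulo.coefficientwise λ i _ → at e i tt

  limit : ∀ {f g} → (∀ n → Modulo._≈_ n f g) → f ≈ g
  limit e = coefficientwise λ i _ → Modulo.at (e i) i ℕ.≤-refl

  q⊛-shift : ∀ f n → (q ⊛ f) (suc n) ≋ f n
  q⊛-shift f n = ≋-reflexive (⊛-identityˡ f n)

  q^⊛-shift : ∀ m f n → (q ^ m ⊛ f) (m + n) ≋ f n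
  q^⊛-shift zero    f n = ≋-reflexive (⊛-identityˡ f n)
  q^⊛-shift (suc m) f n = ≋-trans (at (*-assoc q (q ^ m) f) (suc m + n) tt)
    (≋-trans (q⊛-shift (q ^ m ⊛ f) (m + n)) (q^⊛-shift m f n))

  LowOrder : ℕ → Series → Set
  LowOrder m f = ∀ i → i < m → f i ≋ 0

  low⇒≈0 : ∀ {n m f} → n < m → LowOrder m f → Modulo._≈_ n f 𝟎
  low⇒≈0 n<m low = Modulo.coefficientwise λ i i≤n → low i (ℕ.≤-<-trans i≤n n<m)

  low-⊛ʳ : ∀ f {m g} → LowOrder m g → LowOrder m (f ⊛ g)
  low-⊛ʳ f {m} {g} low i i<m = Modulo.at
    (M.trans (M.*-congˡ {f} (low⇒≈0 i<m low)) (M.zeroʳ f)) i ℕ.≤-refl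
    where module M = Modulo i

  low-⊛ˡ : ∀ {m f} g → LowOrder m f → LowOrder m (f ⊛ g)
  low-⊛ˡ {f = f} g low i i<m = ≋-trans (≋-reflexive (⊛-comm f g i)) (low-⊛ʳ g low i i<m)

  low-⊛ : ∀ {f m g} → f 0 ≋ 0 → LowOrder m g → LowOrder (suc m) (f ⊛ g)
  low-⊛ f0 low zero    _         = ≋-* f0 ≋-refl
  low-⊛ {f} f0 low (suc i) (s≤s l) = ≋-+ (≋-* f0 ≋-refl) (low-⊛ʳ (tail f) low i l)

  low-^ : ∀ {f} → f 0 ≋ 0 → ∀ m → LowOrder m (f ^ m)
  low-^ f0 zero    i ()
  low-^ f0 (suc m) = low-⊛ f0 (low-^ f0 m)

  low-mono : ∀ {m n f} → m ≤ n → LowOrder n f → LowOrder m f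
  low-mono m≤n low i i<m = low i (ℕ.≤-trans i<m m≤n)

  -- The two-sided infinite sum of E, provided that E x has order at least ∣ x ∣.
  Θ : (ℤ → Series) → Series
  Θ E n = ∑ n E n

  Θ-approx : ∀ {E} → (∀ x → LowOrder ℤ.∣ x ∣ (E x)) → ∀ {m n} → n ≤ m → Modulo._≈_ n (Θ E) (∑ m E)
  Θ-approx low {m} {n} n≤m = Modulo.coefficientwise λ i i≤n →
    ≋-sym (Modulo.at (Modulo.∑-stable i (λ x l → low⇒≈0 l (low x)) (ℕ.≤-trans i≤n n≤m)) i ℕ.≤-refl)

  constant : ℕ → Series
  constant a zero    = a
  constant a (suc _) = 0

  constant-⊛ : ∀ a f n → (constant a ⊛ f) n ≡ a * f n
  constant-⊛ a f zero    = ≡.refl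
  constant-⊛ a f (suc n) = ≡.trans (≡.cong (λ k → a * f (suc n) + k) (⊛-zeroˡ f n)) (ℕ.+-identityʳ _)

  fermat : ∀ a → a * (a * (a * (a * (a * 1)))) ≋ a
  fermat a = ≋-trans (power residue) (≋-trans (residues (a % 5) (ℕ.m%n<n a 5)) (≋-sym residue))
    where
    residue : a ≋ a % 5
    residue = mod≡ (≡.sym (ℕ.m%n%n≡m%n a 5))
    power : ∀ {a b} → a ≋ b → a * (a * (a * (a * (a * 1)))) ≋ b * (b * (b * (b * (b * 1))))
    power e = ≋-* e (≋-* e (≋-* e (≋-* e (≋-* e ≋-refl))))
    residues : ∀ r → r < 5 → r * (r * (r * (r * (r * 1)))) ≋ r
    residues 0 _ = ≋-refl
    residues 1 _ = ≋-refl
    residues 2 _ = mod≡ ≡.refl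
    residues 3 _ = mod≡ ≡.refl
    residues 4 _ = mod≡ ≡.refl
    residues (suc (suc (suc (suc (suc _))))) (s≤s (s≤s (s≤s (s≤s (s≤s ())))))

  constant^5 : ∀ a → constant a ^ 5 ≈ constant a
  constant^5 a = trans (from-≡ powers) (coefficientwise λ { zero _ → fermat a ; (suc i) _ → ≋-refl })
    where
    scale : ∀ b n → a * constant b n ≡ constant (a * b) n
    scale b zero    = ≡.refl
    scale b (suc _) = ℕ.*-zeroʳ a
    times : ∀ {f b} → (∀ n → f n ≡ constant b n) → ∀ n → (constant a ⊛ f) n ≡ constant (a * b) n
    times {f} {b} e n = ≡.trans (constant-⊛ a f n) (≡.trans (≡.cong (a *_) (e n)) (scale b n))
    one : ∀ n → 𝟏 n ≡ constant 1 n
    one zero    = ≡.refl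
    one (suc _) = ≡.refl
    powers : ∀ n → (constant a ^ 5) n ≡ constant (a * (a * (a * (a * (a * 1))))) n
    powers = times (times (times (times (times one))))

  split-head : ∀ f → f ≈ constant (f 0) ⊕ q ⊛ tail f
  split-head f = coefficientwise λ
    { zero _    → ≋-reflexive (≡.sym (ℕ.+-identityʳ (f 0)))
    ; (suc i) _ → ≋-sym (q⊛-shift (tail f) i) }

  -- Frobenius applied to f = f(0) + q · tail, the constant being its own fifth power by Fermat.
  -- Repeated along the tails, this spreads the coefficients of f over the multiples of 5.
  ^5-split : ∀ f → f ^ 5 ≈ constant (f 0) ⊕ q ^ 5 ⊛ tail f ^ 5
  ^5-split f = trans (^-congˡ 5 (split-head f)) (trans (frobenius-+ (constant (f 0)) (q ⊛ tail f))
    (+-cong (constant^5 (f 0)) (^-distrib-* q (tail f) 5)))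

  U : ℕ → Series → Series
  U r f n = f (n * 5 + r)

  U-cong : ∀ r {f g} → f ≈ g → U r f ≈ U r g
  U-cong r e = coefficientwise λ n _ → at e (n * 5 + r) tt

  -- Over the field of five elements f ^ 5 is f(q^5).
  U-^5⊛ : ∀ r → r < 5 → ∀ f g → U r (f ^ 5 ⊛ g) ≈ f ⊛ U r g
  U-^5⊛ r r<5 f g = coefficientwise λ n _ → coefficient f n
    where
    expand : ∀ f → f ^ 5 ⊛ g ≈ constant (f 0) ⊛ g ⊕ q ^ 5 ⊛ (tail f ^ 5 ⊛ g)
    expand f = trans (*-congʳ {g} (^5-split f)) (trans (distribʳ g (constant (f 0)) (q ^ 5 ⊛ tail f ^ 5))
      (+-congˡ {constant (f 0) ⊛ g} (*-assoc (q ^ 5) (tail f ^ 5) g)))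
    coefficient : ∀ f n → U r (f ^ 5 ⊛ g) n ≋ (f ⊛ U r g) n
    coefficient f zero = ≋-trans (at (expand f) r tt) (≋-trans
      (≋-+ (≋-reflexive (constant-⊛ (f 0) g r)) (low-⊛ˡ {5} (tail f ^ 5 ⊛ g) (low-^ ≋-refl 5) r r<5))
      (≋-reflexive (ℕ.+-identityʳ _)))
    coefficient f (suc n) = ≋-trans (at (expand f) (5 + (n * 5 + r)) tt) (≋-+
      (≋-reflexive (constant-⊛ (f 0) g (5 + (n * 5 + r))))
      (≋-trans (q^⊛-shift 5 (tail f ^ 5 ⊛ g) (n * 5 + r)) (coefficient (tail f) n)))

  U-q⊛ : ∀ r f → U (suc r) (q ⊛ f) ≈ U r f
  U-q⊛ r f = coefficientwise λ n _ → ≋-trans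
    (≋-reflexive (≡.cong (q ⊛ f) (ℕ.+-suc (n * 5) r))) (q⊛-shift f (n * 5 + r))

  -- Multiplication by q moves class 4 to class 0 of the next block of five; the carry q^5 is read
  -- as q after extraction.
  U₀-q⊛ : ∀ f → U 0 (q ⊛ f) ≈ q ⊛ U 4 f
  U₀-q⊛ f = coefficientwise λ
    { zero _    → ≋-refl
    ; (suc n) _ → ≋-trans (q⊛-shift f (4 + (n * 5 + 0)))
        (≋-trans (≋-reflexive (≡.cong f (lemma n))) (≋-sym (q⊛-shift (U 4 f) n))) }
    where
    lemma : ∀ n → 4 + (n * 5 + 0) ≡ n * 5 + 4
    lemma = ℕ-Solver.solve-∀

  -- `U 0` undoes the fifth power. This brings the two-squares identity from q^5 back to q.
  ^5-injective : ∀ {f g} → f ^ 5 ≈ g ^ 5 → f ≈ g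
  ^5-injective {f} {g} e = trans (sym (root f)) (trans (U-cong 0 e) (root g))
    where
    U₀-𝟏 : U 0 𝟏 ≈ 𝟏
    U₀-𝟏 = coefficientwise λ { zero _ → ≋-refl ; (suc n) _ → ≋-refl }
    root : ∀ f → U 0 (f ^ 5) ≈ f
    root f = trans (U-cong 0 (sym (*-identityʳ (f ^ 5)))) (trans (U-^5⊛ 0 (s≤s z≤n) f 𝟏)
      (trans (*-congˡ {f} U₀-𝟏) (*-identityʳ f)))

open Multisection

-- The theta series and its 5-dissection

module ThetaSeries where

  open Full hiding (_-_)

  -- (-1)^x q^(x²) is p ^ sq x, as x and x² have the same parity.
  p : Series
  p = ⊖ q

  p0 : p 0 ≋ 0
  p0 = ≋-refl

  θ : Series
  θ = Θ (λ x → p ^ sq x)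

  -- p ^ sq (r + 5k) is p ^ (r² % 5) times the value of p ^ quotient r k at q^5.
  quotient : ℤ → ℤ → ℕ
  quotient r k = sq (r ℤ.+ k ℤ.* + 5) / 5

  square-%5 : ∀ c m → (c + m * 5) * (c + m * 5) % 5 ≡ c * c % 5
  square-%5 c m = ≡.trans (≡.cong (_% 5) (lemma c m)) (ℕ.[m+kn]%n≡m%n (c * c) (m * (c + c) + m * m * 5) 5)
    where
    lemma : ∀ c m → (c + m * 5) * (c + m * 5) ≡ c * c + (m * (c + c) + m * m * 5) * 5
    lemma = ℕ-Solver.solve-∀

  -- Growth of the exponents, which makes β and γ well-defined infinite sums. The smallest base
  -- suffices: (5m + 3)² ≥ 5(m + 1).
  square-bound : ∀ c m → suc m ≤ (3 + c + m * 5) * (3 + c + m * 5) / 5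
  square-bound c m = ℕ.≤-trans (ℕ.≤-reflexive (≡.sym (ℕ.m*n/n≡m (suc m) 5))) (ℕ./-monoˡ-≤ 5
    (ℕ.≤-trans (ℕ.≤-trans (ℕ.m≤m+n (suc m * 5) _) (ℕ.≤-reflexive (lemma m)))
      (ℕ.*-mono-≤ base base)))
    where
    lemma : ∀ m → suc m * 5 + (4 + 25 * m + 25 * (m * m)) ≡ (3 + m * 5) * (3 + m * 5)
    lemma = ℕ-Solver.solve-∀
    base : 3 + m * 5 ≤ 3 + c + m * 5
    base = ℕ.+-monoˡ-≤ (m * 5) (ℕ.m≤m+n 3 c)

  sq-%5₁ : ∀ k → sq (+ 1 ℤ.+ k ℤ.* + 5) % 5 ≡ 1
  sq-%5₁ (+ zero)  = ≡.refl
  sq-%5₁ (+ suc m) = square-%5 6 m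
  sq-%5₁ -[1+ m ]  = square-%5 4 m

  sq-%5₂ : ∀ k → sq (+ 2 ℤ.+ k ℤ.* + 5) % 5 ≡ 4
  sq-%5₂ (+ zero)  = ≡.refl
  sq-%5₂ (+ suc m) = square-%5 7 m
  sq-%5₂ -[1+ m ]  = square-%5 3 m

  quotient-bound₁ : ∀ k → ℤ.∣ k ∣ ≤ quotient (+ 1) k
  quotient-bound₁ (+ zero)  = z≤n
  quotient-bound₁ (+ suc m) = square-bound 3 m
  quotient-bound₁ -[1+ m ]  = square-bound 1 m

  quotient-bound₂ : ∀ k → ℤ.∣ k ∣ ≤ quotient (+ 2) k
  quotient-bound₂ (+ zero)  = z≤n
  quotient-bound₂ (+ suc m) = square-bound 4 m
  quotient-bound₂ -[1+ m ]  = square-bound 0 m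

  β γ : Series
  β = Θ (λ k → p ^ quotient (+ 1) k)
  γ = Θ (λ k → p ^ quotient (+ 2) k)

  -- The classes of x and -x agree, hence the factors 2; the sign of `B` comes from p = -q. Since
  -- 2^5 = 2 and (-1)^5 = -1 modulo 5, these constants can be moved inside the fifth powers.
  B C : Series
  B = ⊖ (β ⊕ β)
  C = γ ⊕ γ

  module Approximate (n : ℕ) where
    private module M = Modulo n
    open M using () renaming (_≈_ to _≈ₙ_)

    p^>n≈0 : ∀ {m} → n < m → p ^ m ≈ₙ 𝟎
    p^>n≈0 {m} n<m = low⇒≈0 n<m (low-^ p0 m)

    open M.TwoSquares p n p^>n≈0 public

    ∑-^5 : ∀ m f → ∑ m f ^ 5 ≈ₙ ∑ m (λ x → f x ^ 5)
    ∑-^5 zero    f = M.refl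
    ∑-^5 (suc m) f = M.trans (M.frobenius-+ (∑ m f) _)
      (M.+-cong (∑-^5 m f) (M.frobenius-+ (f (+ suc m)) (f -[1+ m ])))

    θ-approx : ∀ {m} → n ≤ m → θ ≈ₙ ∑ m e
    θ-approx = Θ-approx (λ x → low-mono (∣n∣≤sq x) (low-^ p0 (sq x)))

    θ^5-approx : ∀ {m} → n ≤ m → θ ^ 5 ≈ₙ ∑ m v
    θ^5-approx {m} n≤m = M.trans (M.^-congˡ 5 (θ-approx n≤m)) (∑-^5 m e)

    class₀ : ∀ {m} → n ≤ m → class (+ 0) m ≈ₙ (θ ^ 5) ^ 5
    class₀ {m} n≤m = M.sym (M.trans (M.^-congˡ 5 (θ^5-approx n≤m)) (M.trans (∑-^5 m v) (M.∑-cong m λ k _ →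
      M.trans (M.^-congˡ 5 (M.^-assocʳ p (sq k) 5)) (M.trans (M.^-assocʳ p (sq k * 5) 5)
        (M.^-congʳ p (≡.sym (lemma k)))))))
      where
      lemma : ∀ k → sq (+ 0 ℤ.+ k ℤ.* + 5) ≡ sq k * 5 * 5
      lemma k = ≡.trans (≡.cong sq (ℤ.+-identityˡ (k ℤ.* + 5)))
        (≡.trans (≡.cong₂ _*_ (ℤ.abs-* k (+ 5)) (ℤ.abs-* k (+ 5))) (polynomial ℤ.∣ k ∣))
        where
        polynomial : ∀ a → (a * 5) * (a * 5) ≡ a * a * 5 * 5
        polynomial = ℕ-Solver.solve-∀

    class-quotient : ∀ r s → (∀ k → sq (r ℤ.+ k ℤ.* + 5) % 5 ≡ s) → (∀ k → ℤ.∣ k ∣ ≤ quotient r k) →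
      ∀ {m} → n ≤ m → class r m ≈ₙ p ^ s ⊛ Θ (λ k → p ^ quotient r k) ^ 5
    class-quotient r s residue bound {m} n≤m = M.sym (M.trans
      (M.*-congˡ {p ^ s} (M.trans (M.^-congˡ 5 (Θ-approx (λ k → low-mono (bound k) (low-^ p0 (quotient r k))) n≤m))
                                  (∑-^5 m _)))
      (M.trans (M.∑-*ˡ m (p ^ s) _) (M.∑-cong m λ k _ →
        M.trans (M.*-congˡ {p ^ s} (M.^-assocʳ p (quotient r k) 5))
        (M.trans (M.sym (M.^-homo-* p s (quotient r k * 5))) (M.^-congʳ p (≡.sym (lemma k)))))))
      where
      lemma : ∀ k → sq (r ℤ.+ k ℤ.* + 5) ≡ s + quotient r k * 5
      lemma k = ≡.trans (ℕ.m≡m%n+[m/n]*n (sq (r ℤ.+ k ℤ.* + 5)) 5) (≡.cong (_+ quotient r k * 5) (residue k))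

    class₁ : ∀ {m} → n ≤ m → class (+ 1) m ≈ₙ p ^ 1 ⊛ β ^ 5
    class₁ = class-quotient (+ 1) 1 sq-%5₁ quotient-bound₁

    class₂ : ∀ {m} → n ≤ m → class (+ 2) m ≈ₙ p ^ 4 ⊛ γ ^ 5
    class₂ = class-quotient (+ 2) 4 sq-%5₂ quotient-bound₂

    θ-dissectionₙ : θ ≈ₙ (θ ^ 5) ^ 5 ⊕ (q ⊛ B ^ 5 ⊕ q ^ 4 ⊛ C ^ 5)
    θ-dissectionₙ = M.trans (θ-approx (ℕ.≤-trans (ℕ.m≤m*n n 5) (ℕ.m≤n+m (n * 5) 2)))
      (M.trans (M.∑-dissect n e) (M.trans
        (M.+-cong (class₀ ℕ.≤-refl) (M.+-cong
          (M.+-cong (class₁ ℕ.≤-refl) (M.trans (class-neg (+ 1) n) (class₁ ℕ.≤-refl)))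
          (M.+-cong (class₂ ℕ.≤-refl) (M.trans (class-neg (+ 2) n) (class₂ ℕ.≤-refl)))))
        (M.+-congˡ {(θ ^ 5) ^ 5} (M.nonzero-classes q β γ))))

    -- The norm identity has exponents 5x² + 5y² on its left, so it computes the square of θ(q^5),
    -- which is the fifth power of θ².
    two-squaresₙ : (θ ⊛ θ) ^ 5 ≈ₙ (θ ^ 5 ⊛ θ ^ 5 ⊕ q ⊛ (B ⊛ C)) ^ 5
    two-squaresₙ = M.trans (M.^-distrib-* θ θ 5) (M.trans (M.*-cong (θ^5-approx ℕ.≤-refl) (θ^5-approx ℕ.≤-refl))
      (M.trans two-squares (M.trans
        (M.+-cong (M.*-cong (class₀ ℕ.≤-refl) (class₀ n≤m)) (M.+-cong
          (M.+-cong (M.*-cong (class₁ ℕ.≤-refl) (class₂ n≤m)) (M.*-cong (class₁ ℕ.≤-refl) (class₂ n≤m)))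
          (M.+-cong (M.*-cong (class₂ ℕ.≤-refl) (class₁ n≤m)) (M.*-cong (class₂ ℕ.≤-refl) (class₁ n≤m)))))
        (M.trans (M.class-products (θ ^ 5) q β γ)
        (M.sym (M.frobenius-+ (θ ^ 5 ⊛ θ ^ 5) (q ⊛ (B ⊛ C))))))))
      where
      n≤m : n ≤ 1 + 3 * n
      n≤m = ℕ.≤-trans (ℕ.m≤m+n n (2 * n)) (ℕ.m≤n+m (3 * n) 1)

  θ-dissection : θ ≈ (θ ^ 5) ^ 5 ⊕ (q ⊛ B ^ 5 ⊕ q ^ 4 ⊛ C ^ 5)
  θ-dissection = limit Approximate.θ-dissectionₙ

  θ² : θ ⊛ θ ≈ θ ^ 5 ⊛ θ ^ 5 ⊕ q ⊛ (B ⊛ C)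
  θ² = ^5-injective {θ ⊛ θ} (limit Approximate.two-squaresₙ)

open ThetaSeries

-- Sections of powers of θ and the vanishing classes

module ThetaPowers where

  open Full
  open Parts
  open PowerParts (θ ^ 5) B C q

  θ⊛-expand : ∀ f → θ ⊛ f ≈ (θ ^ 5) ^ 5 ⊛ f ⊕ (B ^ 5 ⊛ (q ⊛ f) ⊕ C ^ 5 ⊛ (q ⊛ (q ⊛ (q ⊛ (q ⊛ f)))))
  θ⊛-expand f = trans (*-congʳ {f} θ-dissection) (expansion ((θ ^ 5) ^ 5) (B ^ 5) (C ^ 5) q f)

  U-θ⊛ : ∀ r → r < 5 → ∀ f {g h} → U r (q ⊛ f) ≈ g → U r (q ⊛ (q ⊛ (q ⊛ (q ⊛ f)))) ≈ h →
    U r (θ ⊛ f) ≈ θ ^ 5 ⊛ U r f ⊕ (B ⊛ g ⊕ C ⊛ h)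
  U-θ⊛ r r<5 f g≈ h≈ = trans (U-cong r (θ⊛-expand f)) (+-cong (U-^5⊛ r r<5 (θ ^ 5) f) (+-cong
    (trans (U-^5⊛ r r<5 B (q ⊛ f)) (*-congˡ {B} g≈))
    (trans (U-^5⊛ r r<5 C (q ⊛ (q ⊛ (q ⊛ (q ⊛ f))))) (*-congˡ {C} h≈))))

  record HasParts (f : Series) (g : Parts Series) : Set where
    constructor hasParts
    field
      U₀ : U 0 f ≈ part₀ g
      U₁ : U 1 f ≈ part₁ g
      U₂ : U 2 f ≈ part₂ g
      U₃ : U 3 f ≈ part₃ g
      U₄ : U 4 f ≈ part₄ g
  open HasParts

  hasParts-𝟏 : HasParts 𝟏 unit
  hasParts-𝟏 = hasParts (coefficientwise λ { zero _ → ≋-refl ; (suc n) _ → ≋-refl })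
    (vanish 0) (vanish 1) (vanish 2) (vanish 3)
    where
    vanish : ∀ r → U (suc r) 𝟏 ≈ 𝟎
    vanish r = coefficientwise λ n _ → ≋-reflexive (≡.cong 𝟏 (ℕ.+-suc (n * 5) r))

  hasParts-step : ∀ {f g} → HasParts f g → HasParts (θ ⊛ f) (step g)
  hasParts-step {f} {g} h = hasParts
    (combine 0 (s≤s z≤n) (U₀ h) (trans (U₀-q⊛ f) (*-congˡ {q} (U₄ h)))
      (trans (U₀-q⊛ _) (*-congˡ {q} (trans (U-q⊛ 3 _) (trans (U-q⊛ 2 _) (trans (U-q⊛ 1 f) (U₁ h)))))))
    (combine 1 (s≤s (s≤s z≤n)) (U₁ h) (trans (U-q⊛ 0 f) (U₀ h))
      (trans (U-q⊛ 0 _) (trans (U₀-q⊛ _) (*-congˡ {q} (trans (U-q⊛ 3 _) (trans (U-q⊛ 2 f) (U₂ h)))))))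
    (combine 2 (s≤s (s≤s (s≤s z≤n))) (U₂ h) (trans (U-q⊛ 1 f) (U₁ h))
      (trans (U-q⊛ 1 _) (trans (U-q⊛ 0 _) (trans (U₀-q⊛ _) (*-congˡ {q} (trans (U-q⊛ 3 f) (U₃ h)))))))
    (combine 3 (s≤s (s≤s (s≤s (s≤s z≤n)))) (U₃ h) (trans (U-q⊛ 2 f) (U₂ h))
      (trans (U-q⊛ 2 _) (trans (U-q⊛ 1 _) (trans (U-q⊛ 0 _) (trans (U₀-q⊛ f) (*-congˡ {q} (U₄ h)))))))
    (combine 4 (s≤s (s≤s (s≤s (s≤s (s≤s z≤n))))) (U₄ h) (trans (U-q⊛ 3 f) (U₃ h))
      (trans (U-q⊛ 3 _) (trans (U-q⊛ 2 _) (trans (U-q⊛ 1 _) (trans (U-q⊛ 0 f) (U₀ h))))))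
    where
    combine : ∀ r → r < 5 → ∀ {k l m} → U r f ≈ k → U r (q ⊛ f) ≈ l → U r (q ⊛ (q ⊛ (q ⊛ (q ⊛ f)))) ≈ m →
      U r (θ ⊛ f) ≈ θ ^ 5 ⊛ k ⊕ (B ⊛ l ⊕ C ⊛ m)
    combine r r<5 {k} {l} {m} e e′ e″ = trans (U-θ⊛ r r<5 f e′ e″) (+-congʳ (*-congˡ {θ ^ 5} e))

  hasParts¹ : HasParts (θ ^ 1) (step unit)
  hasParts¹ = hasParts-step hasParts-𝟏
  hasParts² : HasParts (θ ^ 2) (step (step unit))
  hasParts² = hasParts-step hasParts¹
  hasParts³ : HasParts (θ ^ 3) (step (step (step unit)))
  hasParts³ = hasParts-step hasParts²
  hasParts⁴ : HasParts (θ ^ 4) (step (step (step (step unit))))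
  hasParts⁴ = hasParts-step hasParts³

  θ²≈Q : θ ^ 2 ≈ Q
  θ²≈Q = trans (*-congˡ {θ} (*-identityʳ θ)) θ²

  U₀-θ⁴ : U 0 (θ ^ 4) ≈ θ ^ 4
  U₀-θ⁴ = trans (U₀ hasParts⁴) (trans fourth₀ (trans (*-cong (sym θ²≈Q) (sym θ²≈Q)) (sym (^-homo-* θ 2 2))))

  U₀-θ³ : U 0 (θ ^ 3) ≈ θ ^ 5 ⊛ θ ^ 2
  U₀-θ³ = trans (U₀ hasParts³) (trans cube₀ (*-congˡ {θ ^ 5} (sym θ²≈Q)))

  U₀-θ² : U 0 (θ ^ 2) ≈ (θ ^ 2 ⊕ θ ^ 2) ⊕ ⊖ ((θ ^ 2) ^ 5)
  U₀-θ² = trans (U₀ hasParts²) (trans square₀ (+-cong (+-cong (sym θ²≈Q) (sym θ²≈Q))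
    (-‿cong (trans (sym (^-homo-* θ 5 5)) (sym (^-assocʳ θ 2 5))))))

  θ0 : θ 0 ≋ 1
  θ0 = ≋-refl

  -- V k f is f(q^(5^k)).
  V : ℕ → Series → Series
  V zero    f = f
  V (suc k) f = V k f ^ 5

  -- The bound 4 on the exponent is the number of sections taken: each `U` strips one fifth power
  -- from `V (4 + k) θ`.
  module Congruence (A : Series) (k : ℕ) (Aθ : A ⊛ θ ≈ V (4 + k) θ) where

    private
      T A₁ A₂ A₃ : Series
      T = V k θ
      A₁ = U 0 A
      A₂ = U 0 A₁
      A₃ = U 0 A₂

      0<5 : 0 < 5
      0<5 = s≤s z≤n

    -- A factor θ cannot be moved through `U 0`, but θ^5 leaves it as θ, which cancels because its
    -- constant term is 1.
    first : A₁ ≈ V 3 T ⊛ θ ^ 3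
    first = *-cancelˡ θ θ0 (begin
      θ ⊛ U 0 A                   ≈⟨ U-^5⊛ 0 0<5 θ A ⟨
      U 0 (θ ^ 5 ⊛ A)             ≈⟨ U-cong 0 (y^5*x≈xy*y^4 A θ) ⟩
      U 0 ((A ⊛ θ) ⊛ θ ^ 4)       ≈⟨ U-cong 0 (*-congʳ {θ ^ 4} Aθ) ⟩
      U 0 (V 3 T ^ 5 ⊛ θ ^ 4)     ≈⟨ U-^5⊛ 0 0<5 (V 3 T) (θ ^ 4) ⟩
      V 3 T ⊛ U 0 (θ ^ 4)         ≈⟨ *-congˡ {V 3 T} U₀-θ⁴ ⟩
      V 3 T ⊛ θ ^ 4               ≈⟨ x*yz≈y*xz (V 3 T) θ (θ ^ 3) ⟩
      θ ⊛ (V 3 T ⊛ θ ^ 3)         ∎)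
      where open ≈-Reasoning

    second : A₂ ≈ (V 1 T ⊛ θ) ^ 5 ⊛ θ ^ 2
    second = begin
      U 0 A₁                      ≈⟨ U-cong 0 first ⟩
      U 0 (V 2 T ^ 5 ⊛ θ ^ 3)     ≈⟨ U-^5⊛ 0 0<5 (V 2 T) (θ ^ 3) ⟩
      V 2 T ⊛ U 0 (θ ^ 3)         ≈⟨ *-congˡ {V 2 T} U₀-θ³ ⟩
      V 2 T ⊛ (θ ^ 5 ⊛ θ ^ 2)     ≈⟨ *-assoc (V 2 T) (θ ^ 5) (θ ^ 2) ⟨
      (V 2 T ⊛ θ ^ 5) ⊛ θ ^ 2     ≈⟨ *-congʳ {θ ^ 2} (^-distrib-* (V 1 T) θ 5) ⟨
      (V 1 T ⊛ θ) ^ 5 ⊛ θ ^ 2     ∎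
      where open ≈-Reasoning

    third : A₃ ≈ T ^ 5 ⊛ ((θ ^ 3 ⊕ θ ^ 3) ⊕ ⊖ ((θ ^ 2) ^ 5 ⊛ θ ^ 1))
    third = begin
      U 0 A₂                                                          ≈⟨ U-cong 0 second ⟩
      U 0 ((V 1 T ⊛ θ) ^ 5 ⊛ θ ^ 2)                                   ≈⟨ U-^5⊛ 0 0<5 (V 1 T ⊛ θ) (θ ^ 2) ⟩
      (T ^ 5 ⊛ θ) ⊛ U 0 (θ ^ 2)                                       ≈⟨ *-congˡ {T ^ 5 ⊛ θ} U₀-θ² ⟩
      (T ^ 5 ⊛ θ) ⊛ ((θ ^ 2 ⊕ θ ^ 2) ⊕ ⊖ ((θ ^ 2) ^ 5))               ≈⟨ xy*[2z-w]≈x*[2yz-wy] (T ^ 5) θ (θ ^ 2) ((θ ^ 2) ^ 5) ⟩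
      T ^ 5 ⊛ ((θ ^ 3 ⊕ θ ^ 3) ⊕ ⊖ ((θ ^ 2) ^ 5 ⊛ θ ^ 1))             ∎
      where open ≈-Reasoning

    -- By `third` the section is T (2 U_r θ³ - θ² U_r θ), the factor (θ²)^5 leaving `U r` as θ². As
    -- θ² = Q, the last hypothesis is exactly the cancellation; `cube₁` and `cube₄` supply it.
    U-A₃ : ∀ r → r < 5 → ∀ {x y} → U r (θ ^ 3) ≈ x → U r (θ ^ 1) ≈ y → x ⊕ x ≈ Q ⊛ y → U r A₃ ≈ 𝟎
    U-A₃ r r<5 {x} {y} x≈ y≈ 2x≈Qy = begin
      U r A₃
        ≈⟨ trans (U-cong r third) (U-^5⊛ r r<5 T _) ⟩
      T ⊛ ((U r (θ ^ 3) ⊕ U r (θ ^ 3)) ⊕ ⊖ U r ((θ ^ 2) ^ 5 ⊛ θ ^ 1))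
        ≈⟨ *-congˡ {T} (+-cong (trans (+-cong x≈ x≈) 2x≈Qy) (-‿cong (trans (U-^5⊛ r r<5 (θ ^ 2) (θ ^ 1)) (*-cong θ²≈Q y≈)))) ⟩
      T ⊛ (Q ⊛ y ⊕ ⊖ (Q ⊛ y))
        ≈⟨ trans (*-congˡ {T} (-‿inverseʳ (Q ⊛ y))) (zeroʳ T) ⟩
      𝟎 ∎
      where open ≈-Reasoning

    U₁-A₃ : U 1 A₃ ≈ 𝟎
    U₁-A₃ = U-A₃ 1 (s≤s (s≤s z≤n)) (U₁ hasParts³) (U₁ hasParts¹) cube₁

    U₄-A₃ : U 4 A₃ ≈ 𝟎
    U₄-A₃ = U-A₃ 4 (s≤s (s≤s (s≤s (s≤s (s≤s z≤n))))) (U₄ hasParts³) (U₄ hasParts¹) cube₄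

open ThetaPowers

-- The generating function of the overpartitions

module OverpartitionSeries where

  open Full using (_^_; ∑; ∏)

  sumMult-stop : ∀ f {j m} → m < j → ∀ fuel → sumMult f j m fuel ≡ 0
  sumMult-stop f m<j zero = ≡.refl
  sumMult-stop f {j} {m} m<j (suc fuel) =
    ≡.cong (λ b → if b then f (m ∸ j) + sumMult f j (m ∸ j) fuel else 0) (dec-false (j ≤? m) (ℕ.<⇒≱ m<j))

  sumMult-step : ∀ f j m fuel → sumMult f j (j + m) (suc fuel) ≡ f m + sumMult f j m fuel
  sumMult-step f j m fuel = ≡.trans
    (≡.cong (λ b → if b then f (j + m ∸ j) + sumMult f j (j + m ∸ j) fuel else 0) (dec-true (j ≤? j + m) (ℕ.m≤m+n j m)))
    (≡.cong (λ i → f i + sumMult f j i fuel) (ℕ.m+n∸m≡n j m))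

  sumMult-fuel : ∀ f j {m} fuel fuel′ → m ≤ fuel → m ≤ fuel′ → sumMult f (suc j) m fuel ≡ sumMult f (suc j) m fuel′
  sumMult-fuel f j {m} fuel fuel′ h h′ with suc j ≤? m
  sumMult-fuel f j fuel fuel′ h h′ | no j≰m =
    ≡.trans (sumMult-stop f (ℕ.≰⇒> j≰m) fuel) (≡.sym (sumMult-stop f (ℕ.≰⇒> j≰m) fuel′))
  sumMult-fuel f j {suc m} (suc fuel) (suc fuel′) (s≤s h) (s≤s h′) | yes (s≤s j≤m) =
    ≡.cong (λ i → sumMult f (suc j) i (suc fuel)) split
      ⟨≡⟩ sumMult-step f (suc j) (m ∸ j) fuel
      ⟨≡⟩ ≡.cong (_+_ (f (m ∸ j))) (sumMult-fuel f j fuel fuel′ (ℕ.≤-trans (ℕ.m∸n≤m m j) h) (ℕ.≤-trans (ℕ.m∸n≤m m j) h′))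
      ⟨≡⟩ ≡.sym (sumMult-step f (suc j) (m ∸ j) fuel′)
      ⟨≡⟩ ≡.cong (λ i → sumMult f (suc j) i (suc fuel′)) (≡.sym split)
    where
    infixr 5 _⟨≡⟩_
    _⟨≡⟩_ = ≡.trans
    split : suc m ≡ suc j + (m ∸ j)
    split = ≡.cong suc (≡.sym (ℕ.m+[n∸m]≡n j≤m))

  multiples : ℕ → Series → Series
  multiples j f m = sumMult f (suc j) m m

  -- Taking away one copy of the part leaves either no further copy or again at least one.
  multiples-equation : ∀ j f → multiples j f Full.≈ q ^ suc j ⊛ (f ⊕ multiples j f)
  multiples-equation j f = Full.coefficientwise λ m _ → coefficient m
    where
    coefficient : ∀ m → multiples j f m ≋ (q ^ suc j ⊛ (f ⊕ multiples j f)) m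
    coefficient m with suc j ≤? m
    ... | no j≰m = ≋-trans (≋-reflexive (sumMult-stop f (ℕ.≰⇒> j≰m) m))
      (≋-sym (low-⊛ˡ {suc j} (f ⊕ multiples j f) (low-^ ≋-refl (suc j)) m (ℕ.≰⇒> j≰m)))
    ... | yes j<m = ≡.subst (λ i → multiples j f i ≋ (q ^ suc j ⊛ (f ⊕ multiples j f)) i) (ℕ.m+[n∸m]≡n j<m)
      (≋-trans (≋-reflexive (≡.trans (sumMult-step f (suc j) k (j + k))
          (≡.cong (_+_ (f k)) (sumMult-fuel f j (j + k) k (ℕ.m≤n+m k j) ℕ.≤-refl))))
        (≋-sym (q^⊛-shift (suc j) (f ⊕ multiples j f) k)))
      where
      k : ℕ
      k = m ∸ suc j

  module Product (l n : ℕ) where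

    ℓ : ℕ
    ℓ = suc l

    private module M = Modulo n
    open M using () renaming (_≈_ to _≈ₙ_)
    private
      module G = M.Gauss q
      module Gℓ = M.Gauss (q ^ ℓ)

    O : ℕ → Series
    O = opCount ℓ

    ∏-divisible : (ℕ → Series) → ℕ → Series
    ∏-divisible g zero    = 𝟏
    ∏-divisible g (suc k) = if divides ℓ (suc k) then g (suc k) ⊛ ∏-divisible g k else ∏-divisible g k

    n-factor d-factor : ℕ → Series
    n-factor k = 𝟏 ⊕ ⊖ (q ^ k)
    d-factor k = 𝟏 ⊕ q ^ k

    -- The product formula with denominators cleared: all parts up to k, divided by the same product
    -- over the multiples of ℓ. A forbidden part contributes (1 - z)(1 + z) to both sides.
    opCount-product : ∀ k → (O k ⊛ G.N k) ⊛ ∏-divisible d-factor k ≈ₙ G.D k ⊛ ∏-divisible n-factor k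
    opCount-product zero = M.trans (M.*-identityʳ _) (M.trans (M.*-identityʳ (O 0)) (M.trans
      (M.from-≡ λ { zero → ≡.refl ; (suc i) → ≡.refl }) (M.sym (M.*-identityʳ 𝟏))))
    opCount-product (suc k) with divides ℓ (suc k)
    ... | true  = M.count-forbidden {O k} {q ^ suc k} {G.N k} {∏-divisible d-factor k} {G.D k} {∏-divisible n-factor k}
      (opCount-product k)
    ... | false = M.count-allowed {O k} {_} {q ^ suc k} {G.N k} {∏-divisible d-factor k} {G.D k} {∏-divisible n-factor k}
      (M.trans (M.*-congˡ {n-factor (suc k)} (M.from-≡ λ i → ≡.cong (λ a → O k i + (multiples k (O k) i + a)) (ℕ.+-identityʳ _)))
        (M.allow-part {O k} {multiples k (O k)} {q ^ suc k} (truncate (multiples-equation k (O k)) n)))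
      (opCount-product k)

    divides-false : ∀ i m → i < l → divides ℓ (suc i + m * ℓ) ≡ false
    divides-false i m i<l = ≡.cong (_≡ᵇ 0) (≡.trans (ℕ.[m+kn]%n≡m%n (suc i) m ℓ) (ℕ.m<n⇒m%n≡m (s≤s i<l)))

    divides-true : ∀ m → divides ℓ (m * ℓ) ≡ true
    divides-true m = ≡.cong (_≡ᵇ 0) (ℕ.m*n%n≡0 m ℓ)

    ∏-divisible-gap : ∀ g m i → i ≤ l → ∏-divisible g (i + m * ℓ) ≡ ∏-divisible g (m * ℓ)
    ∏-divisible-gap g m zero    _   = ≡.refl
    ∏-divisible-gap g m (suc i) i<l = ≡.trans
      (≡.cong (if_then g (suc i + m * ℓ) ⊛ ∏-divisible g (i + m * ℓ) else ∏-divisible g (i + m * ℓ)) (divides-false i m i<l))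
      (∏-divisible-gap g m i (ℕ.<⇒≤ i<l))

    ∏-divisible≡∏ : ∀ g m → ∏-divisible g (m * ℓ) ≡ ∏ (λ k → g (k * ℓ)) m
    ∏-divisible≡∏ g zero    = ≡.refl
    ∏-divisible≡∏ g (suc m) = ≡.trans
      (≡.cong (if_then g (suc m * ℓ) ⊛ ∏-divisible g (l + m * ℓ) else ∏-divisible g (l + m * ℓ)) (divides-true (suc m)))
      (≡.cong (g (suc m * ℓ) ⊛_) (≡.trans (∏-divisible-gap g m l ℕ.≤-refl) (∏-divisible≡∏ g m)))

    q^[kℓ] : ∀ k → q ^ (k * ℓ) ≈ₙ (q ^ ℓ) ^ k
    q^[kℓ] k = M.trans (M.^-congʳ q (ℕ.*-comm k ℓ)) (M.sym (M.^-assocʳ q ℓ k))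

    ∏-n-factor : ∀ m → ∏-divisible n-factor (m * ℓ) ≈ₙ Gℓ.N m
    ∏-n-factor m = M.trans (M.reflexive (∏-divisible≡∏ n-factor m))
      (M.∏-cong (λ k → M.+-congˡ {𝟏} (M.-‿cong (q^[kℓ] k))) m)

    ∏-d-factor : ∀ m → ∏-divisible d-factor (m * ℓ) ≈ₙ Gℓ.D m
    ∏-d-factor m = M.trans (M.reflexive (∏-divisible≡∏ d-factor m))
      (M.∏-cong (λ k → M.+-congˡ {𝟏} (q^[kℓ] k)) m)

    opCount-stable : ∀ d i → opCount ℓ (d + i) i ≡ opCount ℓ i i
    opCount-stable zero    i = ≡.refl
    opCount-stable (suc d) i with divides ℓ (suc (d + i))
    ... | true  = opCount-stable d i
    ... | false = ≡.trans (≡.cong (λ a → O (d + i) i + 2 * a) (sumMult-stop (O (d + i)) (s≤s (ℕ.m≤n+m i d)) i))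
      (≡.trans (ℕ.+-identityʳ _) (opCount-stable d i))

    Abar≈O : ∀ {k} → n ≤ k → Abar ℓ ≈ₙ O k
    Abar≈O {k} n≤k = M.coefficientwise λ i i≤n → ≋-sym (≋-reflexive (≡.trans
      (≡.cong (λ k → O k i) (≡.sym (ℕ.m∸n+n≡m (ℕ.≤-trans i≤n n≤k)))) (opCount-stable (k ∸ i) i)))

    ∏-head : ∀ g → (∀ k → g (suc k) 0 ≋ 1) → ∀ k → ∏ g k 0 ≋ 1
    ∏-head g h zero    = ≋-refl
    ∏-head g h (suc k) = ≋-* (h k) (∏-head g h k)

    θℓ : Series
    θℓ = Θ (λ x → (⊖ (q ^ ℓ)) ^ sq x)

    θℓ-approx : ∀ {m} → n ≤ m → θℓ ≈ₙ ∑ m (λ x → (⊖ (q ^ ℓ)) ^ sq x)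
    θℓ-approx = Θ-approx (λ x → low-mono (∣n∣≤sq x) (low-^ ≋-refl (sq x)))

    q^>n≈0 : ∀ {m} → n < m → q ^ m ≈ₙ 𝟎
    q^>n≈0 {m} n<m = low⇒≈0 n<m (low-^ ≋-refl m)

    -- Gauss's identity is used twice, for q and for q^ℓ; the products of factors 1 + q^j have
    -- constant term 1 and can be cancelled.
    Abar-θₙ : Abar ℓ ⊛ θ ≈ₙ θℓ
    Abar-θₙ = M.*-cancelˡ (G.D k ⊛ Gℓ.D n)
      (≋-* (∏-head d-factor (λ _ → ≋-refl) k) (∏-head (λ k → 𝟏 ⊕ (q ^ ℓ) ^ k) (λ _ → ≋-refl) n))
      (begin
        (G.D k ⊛ Gℓ.D n) ⊛ (Abar ℓ ⊛ θ)            ≈⟨ M.xy*zw≈zxw*y (G.D k) (Gℓ.D n) (Abar ℓ) θ ⟩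
        (Abar ℓ ⊛ (G.D k ⊛ θ)) ⊛ Gℓ.D n            ≈⟨ M.*-congʳ {Gℓ.D n} (M.*-cong (Abar≈O n≤k) gauss-k) ⟩
        (O k ⊛ G.N k) ⊛ Gℓ.D n                     ≈⟨ M.*-congˡ {O k ⊛ G.N k} (∏-d-factor n) ⟨
        (O k ⊛ G.N k) ⊛ ∏-divisible d-factor k     ≈⟨ opCount-product k ⟩
        G.D k ⊛ ∏-divisible n-factor k             ≈⟨ M.*-congˡ {G.D k} (M.trans (∏-n-factor n) (M.sym gauss-n)) ⟩
        G.D k ⊛ (Gℓ.D n ⊛ θℓ)                      ≈⟨ M.*-assoc (G.D k) (Gℓ.D n) θℓ ⟨
        (G.D k ⊛ Gℓ.D n) ⊛ θℓ                      ∎)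
      where
      open M.≈-Reasoning
      k : ℕ
      -- The multiples of ℓ up to nℓ are ℓ, 2ℓ, ..., nℓ, so the products over them are `Gℓ.D n` and
      -- `Gℓ.N n` without remainder.
      k = n * ℓ
      n≤k : n ≤ k
      n≤k = ℕ.m≤m*n n ℓ
      gauss-k : G.D k ⊛ θ ≈ₙ G.N k
      gauss-k = M.trans (M.*-congˡ {G.D k} (Approximate.θ-approx n n≤k)) (G.gauss-nilpotent k (q^>n≈0 (s≤s n≤k)))
      gauss-n : Gℓ.D n ⊛ θℓ ≈ₙ Gℓ.N n
      gauss-n = M.trans (M.*-congˡ {Gℓ.D n} (θℓ-approx ℕ.≤-refl)) (Gℓ.gauss-nilpotent n
        (M.trans (M.sym (q^[kℓ] (suc n))) (q^>n≈0 (ℕ.m≤m*n (suc n) ℓ))))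

open OverpartitionSeries

-- Theta at q^(5^k) and the two progressions

open import Data.Nat using (_^_)
open Full using () renaming (_^_ to _^ˢ_)

module FrobeniusPowers (n : ℕ) where
  private module M = Modulo n
  open M using () renaming (_≈_ to _≈ₙ_)
  open Approximate n using (∑-^5; e; θ-approx)

  V-cong : ∀ k {f g} → f ≈ₙ g → V k f ≈ₙ V k g
  V-cong zero    f≈g = f≈g
  V-cong (suc k) f≈g = M.^-congˡ 5 (V-cong k f≈g)

  V-∑ : ∀ k m f → V k (M.∑ m f) ≈ₙ M.∑ m (λ x → V k (f x))
  V-∑ zero    m f = M.refl
  V-∑ (suc k) m f = M.trans (M.^-congˡ 5 (V-∑ k m f)) (∑-^5 m (λ x → V k (f x)))

  V-^ : ∀ k f m → V k (f ^ˢ m) ≈ₙ V k f ^ˢ m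
  V-^ zero    f m = M.refl
  V-^ (suc k) f m = M.trans (M.^-congˡ 5 (V-^ k f m)) (M.^5-comm (V k f) m)

  V-p : ∀ k → V k p ≈ₙ ⊖ (q ^ˢ (5 ^ k))
  V-p zero    = M.-‿cong (M.sym (M.*-identityʳ q))
  V-p (suc k) = M.trans (M.^-congˡ 5 (V-p k)) (M.trans (M.[-x]^5 (q ^ˢ (5 ^ k)))
    (M.-‿cong (M.trans (M.^-assocʳ q (5 ^ k) 5) (M.^-congʳ q (ℕ.*-comm (5 ^ k) 5)))))

  -- Iterated Frobenius acts on a partial sum term by term and commutes with powers; the sign of p
  -- survives because 5 is odd.
  V-θ : ∀ k → V k θ ≈ₙ Θ (λ x → (⊖ (q ^ˢ (5 ^ k))) ^ˢ sq x)
  V-θ k = M.trans (V-cong k (θ-approx ℕ.≤-refl)) (M.trans (V-∑ k n e) (M.trans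
    (M.∑-cong n (λ x _ → M.trans (V-^ k p (sq x)) (M.^-congˡ (sq x) (V-p k))))
    (M.sym (Θ-approx (λ x → low-mono (∣n∣≤sq x) (low-^ (≋-* (≋-refl {4}) (head (5 ^ k) {{ℕ.m^n≢0 5 k}})) (sq x))) ℕ.≤-refl))))
    where
    head : ∀ m → .{{ℕ.NonZero m}} → (q ^ˢ m) 0 ≋ 0
    head (suc m) = ≋-refl

Abar-θ : ∀ ℓ .{{_ : ℕ.NonZero ℓ}} → Abar ℓ ⊛ θ Full.≈ Θ (λ x → (⊖ (q ^ˢ ℓ)) ^ˢ sq x)
Abar-θ (suc l) = limit (Product.Abar-θₙ l)

Abar-5^ : ∀ α → Abar (5 ^ α) ⊛ θ Full.≈ V α θ
Abar-5^ α = Full.trans (Abar-θ (5 ^ α) {{ℕ.m^n≢0 5 α}}) (Full.sym (limit λ n → FrobeniusPowers.V-θ n α))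

theorem9 : (n α : ℕ) → 4 ≤ α →
    (Abar (5 ^ α) (625 * n + 125) % 5 ≡ 0) × (Abar (5 ^ α) (625 * n + 500) % 5 ≡ 0)
theorem9 n α 4≤α = ≡.subst Claim (ℕ.m+[n∸m]≡n 4≤α)
  ( ≡.trans (≡.cong (λ m → A m % 5) (lemma₁ n)) (_≋_.%≡% (Full.at (Congruence.U₁-A₃ A k (Abar-5^ (4 + k))) n _))
  , ≡.trans (≡.cong (λ m → A m % 5) (lemma₄ n)) (_≋_.%≡% (Full.at (Congruence.U₄-A₃ A k (Abar-5^ (4 + k))) n _)))
  where
  Claim : ℕ → Set
  Claim α = (Abar (5 ^ α) (625 * n + 125) % 5 ≡ 0) × (Abar (5 ^ α) (625 * n + 500) % 5 ≡ 0)
  k : ℕ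
  k = α ℕ.∸ 4
  A : Series
  A = Abar (5 ^ (4 + k))
  -- In base 5 the index ends in the digits 1000, and in `lemma₄` in 4000: three sections `U 0`,
  -- then `U 1` or `U 4`.
  lemma₁ : ∀ n → 625 * n + 125 ≡ (((n * 5 + 1) * 5 + 0) * 5 + 0) * 5 + 0
  lemma₁ = ℕ-Solver.solve-∀
  lemma₄ : ∀ n → 625 * n + 500 ≡ (((n * 5 + 4) * 5 + 0) * 5 + 0) * 5 + 0
  lemma₄ = ℕ-Solver.solve-∀
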